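{- Let $f(x)\in\mathbb{Z}[x]$ be a monic polynomial all of whose (complex) roots are rational, and suppose that none of the coefficients of $x^0,x^1,\ldots,x^{\deg f}$ in $f$ is divisible by $5$. Then the base $5$ expansion of $\deg(f)+1$ has at most $4$ nonzero digits. -}

module Defs where

open import Level using (Level; _⊔_)
open import Algebra.Apartness.Bundles using (HeytingField; HeytingCommutativeRing)
open import Algebra.Bundles using (CommutativeRing)
import Algebra.Properties.Semiring.Mult as Mult
open import Data.Digit using (toDigits)
open import Data.Fin.Base using (Fin; zero)
open import Data.Fin.Properties using (_≟_)
open import Data.Integer.Base using (ℤ; +_; -[1+_]; 1ℤ)
open import Data.List.Base using (length; filter)
open import Data.Nat.Base using (ℕ; zero; suc)
open import Data.Product.Base using (∃; proj₁)
open import Data.Rational.Base using (ℚ; ↥_; ↧_)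
open import Data.Vec.Base using (Vec; map; foldr′; last)
open import Relation.Binary.PropositionalEquality using (_≡_)
open import Relation.Nullary.Decidable using (¬?)

-- a₀ ∷ a₁ ∷ … ∷ aₙ ∷ [] stands for a₀ + a₁ x + … + aₙ xⁿ.  The index n is the
-- degree as soon as aₙ ≠ 0, in particular for monic polynomials.
Poly : ∀ {a} → Set a → ℕ → Set a
Poly A n = Vec A (suc n)

Monic : ∀ {n} → Poly ℤ n → Set
Monic f = last f ≡ 1ℤ

-- K plays the role of ℂ, which the standard library does not have: the complex
-- numbers are an algebraically closed Heyting field of characteristic zero.
module _ {c ℓ₁ ℓ₂ : Level} (K : HeytingField c ℓ₁ ℓ₂) where
  open HeytingField K
  private
    ring : CommutativeRing c ℓ₁
    ring = HeytingCommutativeRing.commutativeRing heytingCommutativeRing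
  open Mult (CommutativeRing.semiring ring) using (_×_)

  -- Apartness from 0 means invertibility here, so K contains ℚ.
  CharacteristicZero : Set ℓ₂
  CharacteristicZero = ∀ n → (suc n × 1#) # 0#

  eval : ∀ {n} → Poly Carrier n → Carrier → Carrier
  eval p z = foldr′ (λ a r → a + z * r) 0# p

  -- The index suc n makes the polynomial nonconstant.  In a field it is enough
  -- to consider monic polynomials.
  AlgebraicallyClosed : Set (c ⊔ ℓ₁)
  AlgebraicallyClosed =
    ∀ {n} (p : Poly Carrier (suc n)) → last p ≈ 1# → ∃ λ z → eval p z ≈ 0#

  fromℤ : ℤ → Carrier
  fromℤ (+ n)      = n × 1#
  fromℤ (-[1+ n ]) = - (suc n × 1#)

  IsRoot : ∀ {n} → Poly ℤ n → Carrier → Set ℓ₁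
  IsRoot f z = eval (map fromℤ f) z ≈ 0#

  -- z is the image of q = ↥ q / ↧ q.  The denominator is cleared; it is
  -- invertible when K has characteristic zero.
  IsRational : Carrier → Set ℓ₁
  IsRational z = ∃ λ (q : ℚ) → fromℤ (↧ q) * z ≈ fromℤ (↥ q)

nonzeroDigits₅ : ℕ → ℕ
nonzeroDigits₅ n = length (filter (λ d → ¬? (d ≟ zero)) (proj₁ (toDigits 5 n)))

{-# OPTIONS --safe #-}

-- Clearing denominators shows that the roots of f are integers, and 0 is not a root modulo 5, so
-- f ≡ P m = ∏ (x + b)^(m b) modulo 5, where b runs over the nonzero residues.  Write m = r + 5 q.
-- By Frobenius P m (x) = P r (x) · P q (x⁵).  Hence, for any polynomial h, the coefficients of
-- h · P m whose index is j modulo 5 are those of hⱼ · P q, where hⱼ collects the coefficients of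
-- h · P r whose index is j modulo 5.  So if no coefficient of h · P m vanishes for h in a set H,
-- the same holds for q and the set H′ of all these hⱼ.  Starting from H = {1}, the degrees
-- in H stay at most 3: up to scaling only finitely many sets occur.  At each passage from m to q
-- one digit of deg f + 1 is split off and a carry remains, and an exhaustive search through
-- the pairs of a set and a carry shows that at most four of these digits are nonzero.

module Submission where

open import Defs
open import Algebra.Apartness.Bundles using (HeytingField; HeytingCommutativeRing)
open import Algebra.Bundles using (CommutativeRing)
import Algebra.Properties.Ring as RingProperties
import Algebra.Properties.Semiring.Mult as Mult
open import Algebra.Solver.Ring.AlmostCommutativeRing using (fromCommutativeRing)
import Algebra.Solver.Ring.NaturalCoefficients.Default as SemiringSolver
import Algebra.Solver.Ring.Simple as RingSolver
open import Algebra.Structures using (IsCommutativeRing)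
open import Data.Bool.Base using (Bool; true; false; T; _∧_; if_then_else_)
open import Data.Digit using (Expansion; fromDigits; toDigits)
open import Data.Fin.Base as Fin using (Fin; toℕ; fromℕ<)
open import Data.Fin.Patterns using (0F; 1F; 2F; 3F; 4F)
import Data.Fin.Properties as Fin
open import Data.Integer.Base as ℤ using (ℤ; +_; -[1+_]; 0ℤ; 1ℤ)
import Data.Integer.Coprimality as ℤ using (coprime-divisor)
open import Data.Integer.Divisibility using (_∣_)
import Data.Integer.Divisibility.Signed as Signed
import Data.Integer.Properties as ℤ
import Data.Integer.Tactic.RingSolver as ℤ using (solve-∀)
open import Data.List.Base as List
  using (List; []; _∷_; _++_; length; filter; foldr; cartesianProductWith; allFin)
open import Data.List.Membership.Propositional using (_∈_)
open import Data.List.Membership.Propositional.Properties using (∈-cartesianProductWith⁺; ∈-allFin)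
import Data.List.Properties as List
open import Data.List.Relation.Unary.All as All using (All; []; _∷_)
import Data.List.Relation.Unary.All.Properties as All
open import Data.List.Relation.Unary.Any using (Any; here; there; any?)
open import Data.Maybe.Base as Maybe using (Maybe; just; nothing; maybe′)
open import Data.Nat.Base as ℕ using (ℕ; zero; suc; _∸_; _≤_; _<_; s≤s; z≤n; _≡ᵇ_; _<ᵇ_; _≤ᵇ_)
import Data.Nat.Coprimality as Coprimality
import Data.Nat.Divisibility as ℕ
open import Data.Nat.DivMod
  using (_mod_; _/_; _%_; m≡m%n+[m/n]*n; m%n<n; [m+kn]%n≡m%n; m<n⇒m%n≡m)
open import Data.Nat.GeneralisedArithmetic using (fold; fold-+)
import Data.Nat.Properties as ℕ
import Data.Nat.Tactic.RingSolver as ℕ using (solve-∀)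
open import Data.Product.Base using (_×_; _,_; ∃; proj₁; proj₂)
import Data.Product.Properties as Product
open import Data.Rational.Base using (mkℚ)
open import Data.Sum.Base using (inj₂)
open import Data.Vec.Base as Vec using (Vec; []; _∷_; foldr′; last; lookup; sum; _[_]%=_)
import Data.Vec.Properties as Vec
open import Function.Base using (_∘_)
open import Level using (0ℓ)
import Relation.Binary.PropositionalEquality as ≡
open ≡ using (_≡_; _≢_; _≗_)
import Relation.Binary.Reasoning.Setoid as SetoidReasoning
open import Relation.Nullary.Decidable
  using (Dec; yes; no; does; ¬?; _×-dec_; _→-dec_; dec-true; from-yes)
open import Relation.Nullary.Negation using (¬_; contradiction)

-- The ring homomorphism from ℤ

module IntegerHom {c ℓ} (R : CommutativeRing c ℓ) where
  open CommutativeRing R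
  open RingProperties ring
  open Mult semiring renaming (_×_ to infixr 8 _·_)
  open SetoidReasoning setoid

  ι : ℤ → Carrier
  ι (+ n)      = n · 1#
  ι (-[1+ n ]) = - (suc n · 1#)

  ι-neg : ∀ i → ι (ℤ.- i) ≈ - ι i
  ι-neg (+ zero)  = sym -0#≈0#
  ι-neg (+ suc n) = refl
  ι-neg -[1+ n ]  = sym (-‿involutive (suc n · 1#))

  ι-suc : ∀ i → ι (ℤ.suc i) ≈ 1# + ι i
  ι-suc (+ n)        = refl
  ι-suc -[1+ zero ]  = begin
    0#                   ≈⟨ -‿inverseʳ 1# ⟨
    1# - 1#              ≈⟨ +-congˡ (-‿cong (+-identityʳ 1#)) ⟨
    1# - (1# + 0#)       ∎
  ι-suc -[1+ suc n ] = begin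
    - x                  ≈⟨ +-identityˡ (- x) ⟨
    0# - x               ≈⟨ +-congʳ (-‿inverseʳ 1#) ⟨
    1# - 1# - x          ≈⟨ +-assoc 1# (- 1#) (- x) ⟩
    1# + (- 1# - x)      ≈⟨ +-congˡ (-‿+-comm 1# x) ⟩
    1# - (1# + x)        ∎
    where x = suc n · 1#

  ι-+ⁿ : ∀ n j → ι (+ n ℤ.+ j) ≈ ι (+ n) + ι j
  ι-+ⁿ zero    j = trans (reflexive (≡.cong ι (ℤ.+-identityˡ j))) (sym (+-identityˡ (ι j)))
  ι-+ⁿ (suc n) j = begin
    ι (+ suc n ℤ.+ j)          ≡⟨ ≡.cong ι (ℤ.+-assoc 1ℤ (+ n) j) ⟩
    ι (ℤ.suc (+ n ℤ.+ j))      ≈⟨ ι-suc (+ n ℤ.+ j) ⟩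
    1# + ι (+ n ℤ.+ j)         ≈⟨ +-congˡ (ι-+ⁿ n j) ⟩
    1# + (ι (+ n) + ι j)       ≈⟨ +-assoc 1# (ι (+ n)) (ι j) ⟨
    ι (+ suc n) + ι j          ∎

  ι-+ : ∀ i j → ι (i ℤ.+ j) ≈ ι i + ι j
  ι-+ (+ n)      j = ι-+ⁿ n j
  ι-+ i@(-[1+ n ]) j = begin
    ι (i ℤ.+ j)                      ≡⟨ ≡.cong ι (ℤ.neg-involutive (i ℤ.+ j)) ⟨
    ι (ℤ.- (ℤ.- (i ℤ.+ j)))          ≈⟨ ι-neg (ℤ.- (i ℤ.+ j)) ⟩
    - ι (ℤ.- (i ℤ.+ j))              ≡⟨ ≡.cong (λ k → - ι k) (ℤ.neg-distrib-+ i j) ⟩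
    - ι (+ suc n ℤ.+ ℤ.- j)          ≈⟨ -‿cong (ι-+ⁿ (suc n) (ℤ.- j)) ⟩
    - (ι (+ suc n) + ι (ℤ.- j))      ≈⟨ -‿+-comm _ _ ⟨
    ι i - ι (ℤ.- j)                  ≈⟨ +-congˡ (ι-neg (ℤ.- j)) ⟨
    ι i + ι (ℤ.- (ℤ.- j))            ≡⟨ ≡.cong (λ k → ι i + ι k) (ℤ.neg-involutive j) ⟩
    ι i + ι j                        ∎

  ι-*ⁿ : ∀ n j → ι (+ n ℤ.* j) ≈ ι (+ n) * ι j
  ι-*ⁿ zero    j = trans (reflexive (≡.cong ι (ℤ.*-zeroˡ j))) (sym (zeroˡ (ι j)))
  ι-*ⁿ (suc n) j = begin
    ι (+ suc n ℤ.* j)              ≡⟨ ≡.cong ι (ℤ.suc-* (+ n) j) ⟩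
    ι (j ℤ.+ + n ℤ.* j)            ≈⟨ ι-+ j (+ n ℤ.* j) ⟩
    ι j + ι (+ n ℤ.* j)            ≈⟨ +-congˡ (ι-*ⁿ n j) ⟩
    ι j + ι (+ n) * ι j            ≈⟨ +-congʳ (*-identityˡ (ι j)) ⟨
    1# * ι j + ι (+ n) * ι j       ≈⟨ distribʳ (ι j) 1# (ι (+ n)) ⟨
    ι (+ suc n) * ι j              ∎

  ι-* : ∀ i j → ι (i ℤ.* j) ≈ ι i * ι j
  ι-* (+ n)        j = ι-*ⁿ n j
  ι-* i@(-[1+ n ]) j = begin
    ι (i ℤ.* j)                  ≡⟨ ≡.cong ι (ℤ.neg-distribˡ-* (+ suc n) j) ⟨
    ι (ℤ.- (+ suc n ℤ.* j))      ≈⟨ ι-neg (+ suc n ℤ.* j) ⟩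
    - ι (+ suc n ℤ.* j)          ≈⟨ -‿cong (ι-*ⁿ (suc n) j) ⟩
    - (ι (+ suc n) * ι j)        ≈⟨ -‿distribˡ-* (ι (+ suc n)) (ι j) ⟩
    ι i * ι j                    ∎

-- Integer roots

evalℤ : ∀ {n} → Vec ℤ n → ℤ → ℤ
evalℤ f p = foldr′ (λ a r → a ℤ.+ p ℤ.* r) 0ℤ f

-- The coefficients of f / (x - p), in Horner's scheme, are the values at p of the tails of f.
quotient : ∀ {n} → ℤ → Poly ℤ n → Vec ℤ n
quotient p (_ ∷ [])       = []
quotient p (_ ∷ f@(_ ∷ _)) = evalℤ f p ∷ quotient p f

last-quotient : ∀ {n} p (f : Poly ℤ (suc n)) → last (quotient p f) ≡ last f
last-quotient p (_ ∷ a ∷ [])     = ≡.trans (≡.cong (λ x → a ℤ.+ x) (ℤ.*-zeroʳ p)) (ℤ.+-identityʳ a)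
last-quotient p (_ ∷ f@(_ ∷ _ ∷ _)) = last-quotient p f

-- For f : Poly ℤ n this is dⁿ f(p / d).
homogeneous : ∀ {n} → Vec ℤ n → ℤ → ℤ → ℤ
homogeneous []                p d = 0ℤ
homogeneous {suc n} (a ∷ f) p d = a ℤ.* d ℤ.^ n ℤ.+ p ℤ.* homogeneous f p d

-- Modulo `d` only the leading term survives, since every other term carries a factor `d`.
homogeneous-monic : ∀ {n} (f : Poly ℤ n) → Monic f → ∀ p d →
                    ∃ λ k → homogeneous f p d ≡ p ℤ.^ n ℤ.+ k ℤ.* d
homogeneous-monic {zero} (a ∷ []) a≡1 p d rewrite a≡1 = 0ℤ , lemma p d
  where
  lemma : ∀ p d → 1ℤ ℤ.* 1ℤ ℤ.+ p ℤ.* 0ℤ ≡ 1ℤ ℤ.+ 0ℤ ℤ.* d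
  lemma = ℤ.solve-∀
homogeneous-monic {suc n} (a ∷ f) monic p d with homogeneous-monic f monic p d
... | k , eq = a ℤ.* d ℤ.^ n ℤ.+ p ℤ.* k ,
  ≡.trans (≡.cong (λ h → a ℤ.* d ℤ.^ suc n ℤ.+ p ℤ.* h) eq) (lemma a p d k (d ℤ.^ n) (p ℤ.^ n))
  where
  lemma : ∀ a p d k x y → a ℤ.* (d ℤ.* x) ℤ.+ p ℤ.* (y ℤ.+ k ℤ.* d) ≡
                          p ℤ.* y ℤ.+ (a ℤ.* x ℤ.+ p ℤ.* k) ℤ.* d
  lemma = ℤ.solve-∀

coprime-∣^ : ∀ d p n → Coprimality.Coprime ℤ.∣ d ∣ ℤ.∣ p ∣ → d ∣ p ℤ.^ n → d ∣ 1ℤ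
coprime-∣^ d p zero    c d∣ = d∣
coprime-∣^ d p (suc n) c d∣ = coprime-∣^ d p n c (ℤ.coprime-divisor d p (p ℤ.^ n) c d∣)

-- By `homogeneous-monic`, `d` divides the n-th power of `p`; being coprime to `p`, it divides 1.
rational-root-theorem : ∀ {n} (f : Poly ℤ n) → Monic f → ∀ p d →
  Coprimality.Coprime ℤ.∣ p ∣ ℤ.∣ d ∣ → homogeneous f p d ≡ 0ℤ → ℤ.∣ d ∣ ≡ 1
rational-root-theorem {n} f monic p d c eq with homogeneous-monic f monic p d
... | k , eq′ = ℕ.∣1⇒≡1 (coprime-∣^ d p n (Coprimality.sym c)
  (Signed.∣⇒∣ᵤ (Signed.divides (ℤ.- k) (lemma (p ℤ.^ n) k (≡.trans (≡.sym eq′) eq)))))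
  where
  cancel : ∀ x y → x ≡ x ℤ.+ y ℤ.- y
  cancel = ℤ.solve-∀
  lemma : ∀ x k → x ℤ.+ k ℤ.* d ≡ 0ℤ → x ≡ ℤ.- k ℤ.* d
  lemma x k x+kd≡0 = begin
    x                              ≡⟨ cancel x (k ℤ.* d) ⟩
    x ℤ.+ k ℤ.* d ℤ.- k ℤ.* d      ≡⟨ ≡.cong (λ y → y ℤ.- k ℤ.* d) x+kd≡0 ⟩
    0ℤ ℤ.- k ℤ.* d                 ≡⟨ ℤ.+-identityˡ _ ⟩
    ℤ.- (k ℤ.* d)                  ≡⟨ ℤ.neg-distribˡ-* k d ⟩
    ℤ.- k ℤ.* d                    ∎
    where open ≡.≡-Reasoning

module _ {c ℓ₁ ℓ₂} (K : HeytingField c ℓ₁ ℓ₂) where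
  open HeytingField K using (#-irrefl)
  private
    R : CommutativeRing c ℓ₁
    R = HeytingCommutativeRing.commutativeRing (HeytingField.heytingCommutativeRing K)
  open CommutativeRing R
  open RingProperties ring using (-‿involutive; -0#≈0#)
  open IntegerHom R
  open SemiringSolver commutativeSemiring using (solve; _:=_; _:+_; _:*_; con)
  open SetoidReasoning setoid

  fromℤ≡ι : ∀ i → fromℤ K i ≡ ι i
  fromℤ≡ι (+ n)    = ≡.refl
  fromℤ≡ι -[1+ n ] = ≡.refl

  ι-injective : CharacteristicZero K → ∀ i → ι i ≈ 0# → i ≡ 0ℤ
  ι-injective char0 (+ zero)  _  = ≡.refl
  ι-injective char0 (+ suc n) eq = contradiction (char0 n) (#-irrefl eq)
  ι-injective char0 -[1+ n ]  eq = contradiction (char0 n) (#-irrefl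
    (trans (sym (-‿involutive _)) (trans (-‿cong eq) -0#≈0#)))

  -- Unlike `eval`, this also accepts the empty vector, in which the inductions over coefficients
  -- end.
  evalᴷ : ∀ {n} → Vec ℤ n → Carrier → Carrier
  evalᴷ f z = foldr′ (λ a r → a + z * r) 0# (Vec.map (fromℤ K) f)

  evalᴷ-cong : ∀ {n} (f : Vec ℤ n) {y z} → y ≈ z → evalᴷ f y ≈ evalᴷ f z
  evalᴷ-cong []      y≈z = refl
  evalᴷ-cong (a ∷ f) y≈z = +-congˡ (*-cong y≈z (evalᴷ-cong f y≈z))

  evalᴷ-ι : ∀ {n} (f : Vec ℤ n) p → evalᴷ f (ι p) ≈ ι (evalℤ f p)
  evalᴷ-ι []      p = refl
  evalᴷ-ι (a ∷ f) p = begin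
    fromℤ K a + ι p * evalᴷ f (ι p)   ≈⟨ +-cong (reflexive (fromℤ≡ι a)) (*-congˡ (evalᴷ-ι f p)) ⟩
    ι a + ι p * ι (evalℤ f p)         ≈⟨ +-congˡ (ι-* p (evalℤ f p)) ⟨
    ι a + ι (p ℤ.* evalℤ f p)         ≈⟨ ι-+ a (p ℤ.* evalℤ f p) ⟨
    ι (a ℤ.+ p ℤ.* evalℤ f p)         ∎

  -- For `n` coefficients `homogeneous` is scaled by `d` to the power n - 1. The extra factor `ι d`
  -- raises this to n, so that the empty vector needs no negative exponent.
  evalᴷ-homogeneous : ∀ {n} (f : Vec ℤ n) p d z → ι d * z ≈ ι p →
                      ι d * ι (homogeneous f p d) ≈ ι (d ℤ.^ n) * evalᴷ f z
  evalᴷ-homogeneous []                p d z eq = trans (zeroʳ _) (sym (zeroʳ _))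
  evalᴷ-homogeneous {suc n} (a ∷ f) p d z eq = begin
    ι d * ι (a ℤ.* d ℤ.^ n ℤ.+ p ℤ.* h)
      ≈⟨ *-congˡ (trans (ι-+ (a ℤ.* d ℤ.^ n) (p ℤ.* h)) (+-cong (ι-* a (d ℤ.^ n)) (ι-* p h))) ⟩
    ι d * (ι a * ι (d ℤ.^ n) + ι p * ι h)
      ≈⟨ solve 5 (λ d a x p h → d :* (a :* x :+ p :* h) := d :* a :* x :+ p :* (d :* h)) refl
           (ι d) (ι a) (ι (d ℤ.^ n)) (ι p) (ι h) ⟩
    ι d * ι a * ι (d ℤ.^ n) + ι p * (ι d * ι h)
      ≈⟨ +-congˡ (*-cong (sym eq) (evalᴷ-homogeneous f p d z eq)) ⟩
    ι d * ι a * ι (d ℤ.^ n) + ι d * z * (ι (d ℤ.^ n) * evalᴷ f z)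
      ≈⟨ solve 5 (λ d a x z e → d :* a :* x :+ d :* z :* (x :* e) := d :* x :* (a :+ z :* e)) refl
           (ι d) (ι a) (ι (d ℤ.^ n)) z (evalᴷ f z) ⟩
    ι d * ι (d ℤ.^ n) * (ι a + z * evalᴷ f z)
      ≈⟨ *-cong (ι-* d (d ℤ.^ n)) (+-congʳ (reflexive (fromℤ≡ι a))) ⟨
    ι (d ℤ.^ suc n) * (fromℤ K a + z * evalᴷ f z) ∎
    where h = homogeneous f p d

  evalᴷ-quotient : ∀ {n} (f : Poly ℤ n) p z →
                   evalᴷ f z ≈ (z - ι p) * evalᴷ (quotient p f) z + ι (evalℤ f p)
  evalᴷ-quotient (a ∷ []) p z = begin
    fromℤ K a + z * 0#               ≈⟨ +-cong (reflexive (fromℤ≡ι a)) (zeroʳ z) ⟩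
    ι a + 0#                         ≈⟨ +-identityʳ (ι a) ⟩
    ι a                              ≡⟨ ≡.cong ι (lemma a p) ⟩
    ι (a ℤ.+ p ℤ.* 0ℤ)               ≈⟨ +-identityˡ _ ⟨
    0# + ι (a ℤ.+ p ℤ.* 0ℤ)          ≈⟨ +-congʳ (zeroʳ (z - ι p)) ⟨
    (z - ι p) * 0# + ι (a ℤ.+ p ℤ.* 0ℤ) ∎
    where
    lemma : ∀ a p → a ≡ a ℤ.+ p ℤ.* 0ℤ
    lemma = ℤ.solve-∀
  evalᴷ-quotient (a ∷ f@(_ ∷ _)) p z = begin
    fromℤ K a + z * evalᴷ f z
      ≈⟨ +-cong (reflexive (fromℤ≡ι a)) (*-congˡ (evalᴷ-quotient f p z)) ⟩
    ι a + z * ((z - ι p) * g + r)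
      ≈⟨ +-identityˡ _ ⟨
    0# + (ι a + z * ((z - ι p) * g + r))
      -- The solver is one for semirings and sees `- ι p` as an independent variable. Adding this
      -- zero product beforehand supplies the only cancellation required.
      ≈⟨ +-congʳ (trans (*-congʳ (-‿inverseˡ (ι p))) (zeroˡ r)) ⟨
    (- ι p + ι p) * r + (ι a + z * ((z - ι p) * g + r))
      ≈⟨ solve 6 (λ a z n p g r → (n :+ p) :* r :+ (a :+ z :* ((z :+ n) :* g :+ r)) :=
                                  (z :+ n) :* (r :+ z :* g) :+ (a :+ p :* r)) refl
           (ι a) z (- ι p) (ι p) g r ⟩
    (z - ι p) * (r + z * g) + (ι a + ι p * r)
      ≈⟨ +-cong (*-congˡ (+-congʳ (reflexive (fromℤ≡ι (evalℤ f p)))))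
           (trans (ι-+ a (p ℤ.* evalℤ f p)) (+-congˡ (ι-* p (evalℤ f p)))) ⟨
    (z - ι p) * (fromℤ K (evalℤ f p) + z * g) + ι (a ℤ.+ p ℤ.* evalℤ f p) ∎
    where
    g = evalᴷ (quotient p f) z
    r = ι (evalℤ f p)

  rational-root⇒integer-root : CharacteristicZero K → ∀ {n} (f : Poly ℤ n) → Monic f →
    ∀ z → IsRoot K f z → IsRational K z → ∃ λ p → evalℤ f p ≡ 0ℤ
  rational-root⇒integer-root char0 {n} f monic z root (mkℚ p d-1 coprime , eq) =
    p , ι-injective char0 (evalℤ f p) (begin
      ι (evalℤ f p)   ≈⟨ evalᴷ-ι f p ⟨
      evalᴷ f (ι p)   ≈⟨ evalᴷ-cong f z≈p ⟨
      evalᴷ f z       ≈⟨ root ⟩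
      0#              ∎)
    where
    d = + suc d-1
    dz≈p : ι d * z ≈ ι p
    dz≈p = trans eq (reflexive (fromℤ≡ι p))

    homogeneous≡0 : homogeneous f p d ≡ 0ℤ
    homogeneous≡0 with ℤ.i*j≡0⇒i≡0∨j≡0 d (ι-injective char0 (d ℤ.* homogeneous f p d) (begin
      ι (d ℤ.* homogeneous f p d)       ≈⟨ ι-* d (homogeneous f p d) ⟩
      ι d * ι (homogeneous f p d)       ≈⟨ evalᴷ-homogeneous f p d z dz≈p ⟩
      ι (d ℤ.^ suc n) * evalᴷ f z       ≈⟨ *-congˡ root ⟩
      ι (d ℤ.^ suc n) * 0#              ≈⟨ zeroʳ _ ⟩
      0#                                ∎))
    -- The alternative `d ≡ 0ℤ` is impossible because `d` is a successor.
    ... | inj₂ eq = eq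

    d≡1 : suc d-1 ≡ 1
    d≡1 = rational-root-theorem f monic p d (Coprimality.recompute coprime) homogeneous≡0

    z≈p : z ≈ ι p
    z≈p = begin
      z               ≈⟨ *-identityˡ z ⟨
      1# * z          ≈⟨ *-congʳ (+-identityʳ 1#) ⟨
      ι 1ℤ * z        ≡⟨ ≡.cong (λ d → ι (+ d) * z) d≡1 ⟨
      ι d * z         ≈⟨ dz≈p ⟩
      ι p             ∎

  integer-root : CharacteristicZero K → AlgebraicallyClosed K →
    ∀ {n} (f : Poly ℤ (suc n)) → Monic f → (∀ z → IsRoot K f z → IsRational K z) →
    ∃ λ p → evalℤ f p ≡ 0ℤ
  integer-root char0 closed f monic rational =
    let z , root = closed (Vec.map (fromℤ K) f)
          (trans (reflexive (≡.trans (last-map f) (≡.cong (fromℤ K) monic))) (+-identityʳ 1#))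
    in rational-root⇒integer-root char0 f monic z root (rational z root)
    where
    last-map : ∀ {n} (f : Poly ℤ n) → last (Vec.map (fromℤ K) f) ≡ fromℤ K (last f)
    last-map (a ∷ [])        = ≡.refl
    last-map (_ ∷ f@(_ ∷ _)) = last-map f

  -- This hands the hypothesis that all roots are rational down to the quotient.
  quotient-root : ∀ {n} (f : Poly ℤ (suc n)) p → evalℤ f p ≡ 0ℤ →
                  ∀ z → IsRoot K (quotient p f) z → IsRoot K f z
  quotient-root f p fp≡0 z root = begin
    evalᴷ f z
      ≈⟨ evalᴷ-quotient f p z ⟩
    (z - ι p) * evalᴷ (quotient p f) z + ι (evalℤ f p)
      ≈⟨ +-cong (*-congˡ root) (reflexive (≡.cong ι fp≡0)) ⟩
    (z - ι p) * 0# + 0#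
      ≈⟨ trans (+-identityʳ _) (zeroʳ (z - ι p)) ⟩
    0# ∎

open ≡ using (refl; sym; trans; cong; cong₂; subst; isEquivalence; module ≡-Reasoning)

-- Base 5 expansions

sgn : ℕ → ℕ
sgn zero    = 0
sgn (suc _) = 1

nonzeros : Expansion 5 → ℕ
nonzeros ds = length (filter (λ d → ¬? (d Fin.≟ 0F)) ds)

nonzeros-∷ : ∀ d ds → nonzeros (d ∷ ds) ≡ sgn (toℕ d) ℕ.+ nonzeros ds
nonzeros-∷ 0F          ds = refl
nonzeros-∷ (Fin.suc d) ds = refl

-- Each nonzero digit contributes at least 1 to the value. In particular an expansion of 0 has no
-- nonzero digits.
nonzeros-≤ : ∀ ds → nonzeros ds ≤ fromDigits ds
nonzeros-≤ []       = z≤n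
nonzeros-≤ (d ∷ ds) = subst (_≤ fromDigits (d ∷ ds)) (sym (nonzeros-∷ d ds))
  (ℕ.+-mono-≤ (sgn-≤ (toℕ d)) (ℕ.≤-trans (nonzeros-≤ ds) (ℕ.m≤m*n (fromDigits ds) 5)))
  where
  sgn-≤ : ∀ n → sgn n ≤ n
  sgn-≤ zero    = z≤n
  sgn-≤ (suc n) = s≤s z≤n

digit-unique : ∀ (d d′ : Fin 5) x x′ → toℕ d ℕ.+ x ℕ.* 5 ≡ toℕ d′ ℕ.+ x′ ℕ.* 5 →
               toℕ d ≡ toℕ d′ × x ≡ x′
digit-unique d d′ x x′ eq = d≡d′ , ℕ.*-cancelʳ-≡ x x′ 5
  (ℕ.+-cancelˡ-≡ (toℕ d) _ _ (trans eq (cong (ℕ._+ x′ ℕ.* 5) (sym d≡d′))))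
  where
  residue : ∀ (d : Fin 5) x → (toℕ d ℕ.+ x ℕ.* 5) % 5 ≡ toℕ d
  residue d x = trans ([m+kn]%n≡m%n (toℕ d) x 5) (m<n⇒m%n≡m (Fin.toℕ<n d))
  d≡d′ : toℕ d ≡ toℕ d′
  d≡d′ = trans (sym (residue d x)) (trans (cong (_% 5) eq) (residue d′ x′))

-- Two expansions of one number may differ by zeros at the end, so only their counts are compared.
-- Any convenient expansion can then stand in for that of `toDigits`.
nonzeros-unique : ∀ ds ds′ → fromDigits ds ≡ fromDigits ds′ → nonzeros ds ≡ nonzeros ds′
nonzeros-unique []       []         _  = refl
nonzeros-unique []       ds′@(_ ∷ _) eq =
  sym (ℕ.n≤0⇒n≡0 (subst (nonzeros ds′ ≤_) (sym eq) (nonzeros-≤ ds′)))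
nonzeros-unique ds@(_ ∷ _) []       eq =
  ℕ.n≤0⇒n≡0 (subst (nonzeros ds ≤_) eq (nonzeros-≤ ds))
nonzeros-unique (d ∷ ds) (d′ ∷ ds′) eq
  with digit-unique d d′ (fromDigits ds) (fromDigits ds′) eq
... | d≡d′ , n≡n′ = begin
  nonzeros (d ∷ ds)             ≡⟨ nonzeros-∷ d ds ⟩
  sgn (toℕ d) ℕ.+ nonzeros ds     ≡⟨ cong₂ (λ x y → sgn x ℕ.+ y) d≡d′ (nonzeros-unique ds ds′ n≡n′) ⟩
  sgn (toℕ d′) ℕ.+ nonzeros ds′   ≡⟨ nonzeros-∷ d′ ds′ ⟨
  nonzeros (d′ ∷ ds′)           ∎
  where open ≡-Reasoning

nonzeroDigits₅-step : ∀ {d} → d < 5 → ∀ x →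
                      nonzeroDigits₅ (d ℕ.+ x ℕ.* 5) ≡ sgn d ℕ.+ nonzeroDigits₅ x
nonzeroDigits₅-step {d} d<5 x = begin
  nonzeroDigits₅ (d ℕ.+ x ℕ.* 5)
    ≡⟨ nonzeros-unique (proj₁ (toDigits 5 (d ℕ.+ x ℕ.* 5))) (d′ ∷ proj₁ (toDigits 5 x))
         (trans (proj₂ (toDigits 5 (d ℕ.+ x ℕ.* 5)))
         (sym (cong₂ (λ y z → y ℕ.+ z ℕ.* 5) toℕ-d′ (proj₂ (toDigits 5 x))))) ⟩
  nonzeros (d′ ∷ proj₁ (toDigits 5 x))
    ≡⟨ nonzeros-∷ d′ (proj₁ (toDigits 5 x)) ⟩
  sgn (toℕ d′) ℕ.+ nonzeroDigits₅ x
    ≡⟨ cong (λ d → sgn d ℕ.+ nonzeroDigits₅ x) toℕ-d′ ⟩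
  sgn d ℕ.+ nonzeroDigits₅ x ∎
  where
  open ≡-Reasoning
  d′ = fromℕ< d<5
  toℕ-d′ : toℕ d′ ≡ d
  toℕ-d′ = Fin.toℕ-fromℕ< d<5

-- A bound that is much cheaper to evaluate than toDigits, and exact below 5 ^ k.
weight : ℕ → ℕ → ℕ
weight zero    n = n
weight (suc k) n = sgn (n % 5) ℕ.+ weight k (n / 5)

nonzeroDigits₅-≤-weight : ∀ k n → nonzeroDigits₅ n ≤ weight k n
nonzeroDigits₅-≤-weight zero    n =
  subst (nonzeroDigits₅ n ≤_) (proj₂ (toDigits 5 n)) (nonzeros-≤ (proj₁ (toDigits 5 n)))
nonzeroDigits₅-≤-weight (suc k) n = subst (_≤ weight (suc k) n)
  (trans (sym (nonzeroDigits₅-step (m%n<n n 5) (n / 5)))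
         (cong nonzeroDigits₅ (sym (m≡m%n+[m/n]*n n 5))))
  (ℕ.+-monoʳ-≤ (sgn (n % 5)) (nonzeroDigits₅-≤-weight k (n / 5)))

-- Linear factors modulo 5

F₅ : Set
F₅ = Fin 5

infixl 6 _⊕_
infixl 7 _⊗_
infix  8 ⊖_

_⊕_ _⊗_ : F₅ → F₅ → F₅
x ⊕ y = (toℕ x ℕ.+ toℕ y) mod 5
x ⊗ y = (toℕ x ℕ.* toℕ y) mod 5

⊖_ : F₅ → F₅
⊖ x = (5 ∸ toℕ x) mod 5

⊕-⊗-isCommutativeRing : IsCommutativeRing _≡_ _⊕_ _⊗_ ⊖_ 0F 1F
⊕-⊗-isCommutativeRing = record
  { isRing = record
    { +-isAbelianGroup = record
      { isGroup = record
        { isMonoid = record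
          { isSemigroup = record
            { isMagma = record { isEquivalence = isEquivalence ; ∙-cong = cong₂ _⊕_ }
            ; assoc = from-yes (Fin.all? λ x → Fin.all? λ y → Fin.all? λ z →
                (x ⊕ y) ⊕ z Fin.≟ x ⊕ (y ⊕ z))
            }
          ; identity = from-yes (Fin.all? λ x → 0F ⊕ x Fin.≟ x)
                     , from-yes (Fin.all? λ x → x ⊕ 0F Fin.≟ x)
          }
        ; inverse = from-yes (Fin.all? λ x → ⊖ x ⊕ x Fin.≟ 0F)
                  , from-yes (Fin.all? λ x → x ⊕ ⊖ x Fin.≟ 0F)
        ; ⁻¹-cong = cong ⊖_
        }
      ; comm = from-yes (Fin.all? λ x → Fin.all? λ y → x ⊕ y Fin.≟ y ⊕ x)
      }
    ; *-cong = cong₂ _⊗_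
    ; *-assoc = from-yes (Fin.all? λ x → Fin.all? λ y → Fin.all? λ z →
        (x ⊗ y) ⊗ z Fin.≟ x ⊗ (y ⊗ z))
    ; *-identity = from-yes (Fin.all? λ x → 1F ⊗ x Fin.≟ x)
                 , from-yes (Fin.all? λ x → x ⊗ 1F Fin.≟ x)
    ; distrib = from-yes (Fin.all? λ x → Fin.all? λ y → Fin.all? λ z →
                  x ⊗ (y ⊕ z) Fin.≟ x ⊗ y ⊕ x ⊗ z)
              , from-yes (Fin.all? λ x → Fin.all? λ y → Fin.all? λ z →
                  (y ⊕ z) ⊗ x Fin.≟ y ⊗ x ⊕ z ⊗ x)
    }
  ; *-comm = from-yes (Fin.all? λ x → Fin.all? λ y → x ⊗ y Fin.≟ y ⊗ x)
  }

F₅-commutativeRing : CommutativeRing 0ℓ 0ℓ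
F₅-commutativeRing = record { isCommutativeRing = ⊕-⊗-isCommutativeRing }

module F₅ = CommutativeRing F₅-commutativeRing

open RingSolver (fromCommutativeRing F₅-commutativeRing) Fin._≟_
  using (Polynomial; solve; _:=_; _:+_; _:*_; con)

⊗-nonzero : ∀ x y → x ⊗ y ≡ 0F → x ≢ 0F → y ≡ 0F
⊗-nonzero = from-yes (Fin.all? λ x → Fin.all? λ y →
  (x ⊗ y Fin.≟ 0F) →-dec (¬? (x Fin.≟ 0F) →-dec (y Fin.≟ 0F)))

Seq : Set
Seq = ℕ → F₅

-- A Seq is the coefficient sequence of a power series; lin b is multiplication by x + b.
lin : F₅ → Seq → Seq
lin b s zero    = b ⊗ s zero
lin b s (suc i) = s i ⊕ b ⊗ s (suc i)

lins : ∀ {k} → Vec F₅ k → Vec ℕ k → Seq → Seq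
lins []       []       s = s
lins (b ∷ bs) (e ∷ es) s = lins bs es (fold s (lin b) e)

lin-cong : ∀ b {s t} → s ≗ t → lin b s ≗ lin b t
lin-cong b s≗t zero    = cong (b ⊗_) (s≗t zero)
lin-cong b s≗t (suc i) = cong₂ (λ x y → x ⊕ b ⊗ y) (s≗t i) (s≗t (suc i))

lin^-cong : ∀ b e {s t} → s ≗ t → fold s (lin b) e ≗ fold t (lin b) e
lin^-cong b zero    s≗t = s≗t
lin^-cong b (suc e) s≗t = lin-cong b (lin^-cong b e s≗t)

lins-cong : ∀ {k} (bs : Vec F₅ k) es {s t} → s ≗ t → lins bs es s ≗ lins bs es t
lins-cong []       []       s≗t = s≗t
lins-cong (b ∷ bs) (e ∷ es) s≗t = lins-cong bs es (lin^-cong b e s≗t)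

lin-comm : ∀ a b s → lin a (lin b s) ≗ lin b (lin a s)
lin-comm a b s zero = solve 3 (λ a b x → a :* (b :* x) := b :* (a :* x)) refl a b (s 0)
lin-comm a b s (suc zero) =
  solve 4 (λ a b x y → b :* x :+ a :* (x :+ b :* y) := a :* x :+ b :* (x :+ a :* y)) refl
    a b (s 0) (s 1)
lin-comm a b s (suc (suc i)) =
  solve 5 (λ a b x y z → (x :+ b :* y) :+ a :* (y :+ b :* z) :=
                         (x :+ a :* y) :+ b :* (y :+ a :* z)) refl
    a b (s i) (s (suc i)) (s (suc (suc i)))

lin^-comm : ∀ a e b s → fold (lin b s) (lin a) e ≗ lin b (fold s (lin a) e)
lin^-comm a zero    b s i = refl
lin^-comm a (suc e) b s i =
  trans (lin-cong a (lin^-comm a e b s) i) (lin-comm a b (fold s (lin a) e) i)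

lins-lin : ∀ {k} (bs : Vec F₅ k) es b s → lins bs es (lin b s) ≗ lin b (lins bs es s)
lins-lin []       []       b s i = refl
lins-lin (a ∷ bs) (e ∷ es) b s i =
  trans (lins-cong bs es (lin^-comm a e b s) i) (lins-lin bs es b (fold s (lin a) e) i)

lins-lin^ : ∀ {k} (bs : Vec F₅ k) es b e s →
            lins bs es (fold s (lin b) e) ≗ fold (lins bs es s) (lin b) e
lins-lin^ bs es b zero    s i = refl
lins-lin^ bs es b (suc e) s i =
  trans (lins-lin bs es b (fold s (lin b) e) i) (lin-cong b (lins-lin^ bs es b e s) i)

-- Splitting exponents modulo 5, and Frobenius

quotients : ∀ {k} → Vec ℕ k → Vec ℕ k
quotients = Vec.map (_/ 5)

remainders : ∀ {k} → Vec ℕ k → Vec (Fin 5) k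
remainders = Vec.map (_mod 5)

mod-/ : ∀ m → m ≡ m / 5 ℕ.* 5 ℕ.+ toℕ (m mod 5)
mod-/ m = trans (m≡m%n+[m/n]*n m 5)
  (trans (ℕ.+-comm (m % 5) _) (cong (m / 5 ℕ.* 5 ℕ.+_) (sym (Fin.toℕ-fromℕ< (m%n<n m 5)))))

-- Linear factors commute, so those counted by the remainders can all be applied first. The
-- exponents left over are multiples of 5, ready for Frobenius.
lins-split : ∀ {k} (bs : Vec F₅ k) m s →
  lins bs m s ≗ lins bs (Vec.map (ℕ._* 5) (quotients m)) (lins bs (Vec.map toℕ (remainders m)) s)
lins-split []       []      s i = refl
lins-split (b ∷ bs) (e ∷ m) s i = begin
  lins bs m (fold s (lin b) e) i
    ≡⟨ cong (λ e → lins bs m (fold s (lin b) e) i) (mod-/ e) ⟩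
  lins bs m (fold s (lin b) (e / 5 ℕ.* 5 ℕ.+ toℕ (e mod 5))) i
    ≡⟨ cong (λ s → lins bs m s i) (fold-+ s (lin b) (e / 5 ℕ.* 5) {toℕ (e mod 5)}) ⟩
  lins bs m (fold t (lin b) (e / 5 ℕ.* 5)) i
    ≡⟨ lins-split bs m (fold t (lin b) (e / 5 ℕ.* 5)) i ⟩
  lins bs q (lins bs r (fold t (lin b) (e / 5 ℕ.* 5))) i
    ≡⟨ lins-cong bs q (lins-lin^ bs r b (e / 5 ℕ.* 5) t) i ⟩
  lins bs q (fold (lins bs r t) (lin b) (e / 5 ℕ.* 5)) i ∎
  where
  open ≡-Reasoning
  q = Vec.map (ℕ._* 5) (quotients m)
  r = Vec.map toℕ (remainders m)
  t = fold s (lin b) (toℕ (e mod 5))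

sum-split : ∀ {k} (m : Vec ℕ k) →
  sum m ≡ sum (quotients m) ℕ.* 5 ℕ.+ sum (Vec.map toℕ (remainders m))
sum-split []      = refl
sum-split (e ∷ m) = trans (cong₂ ℕ._+_ (mod-/ e) (sum-split m)) (shuffle (e / 5) _ _ _)
  where
  shuffle : ∀ q r s t → q ℕ.* 5 ℕ.+ r ℕ.+ (s ℕ.* 5 ℕ.+ t) ≡ (q ℕ.+ s) ℕ.* 5 ℕ.+ (r ℕ.+ t)
  shuffle = ℕ.solve-∀

-- Applied to the linear form x + b y, this gives a coefficient of the product of (x + b)⁵ with a
-- series.  The solver cannot cope with a variable b, hence the five cases below.
fivefold : ∀ {a} {A : Set a} → (A → A → A) → (u v w x y z : A) → A
fivefold d u v w x y z = d (fourfold u v w x y) (fourfold v w x y z)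
  where
  threefold = λ u v w x → d (d (d u v) (d v w)) (d (d v w) (d w x))
  fourfold  = λ u v w x y → d (threefold u v w x) (threefold v w x y)

-- The inner binomial coefficients of (x + b)⁵ are divisible by 5, and b⁵ = b by Fermat.
fivefold-frobenius : ∀ b u v w x y z →
  fivefold (λ x y → x ⊕ b ⊗ y) u v w x y z ≡ u ⊕ b ⊗ z
fivefold-frobenius = λ
  { 0F → solve 6 (eq 0F) refl
  ; 1F → solve 6 (eq 1F) refl
  ; 2F → solve 6 (eq 2F) refl
  ; 3F → solve 6 (eq 3F) refl
  ; 4F → solve 6 (eq 4F) refl
  }
  where
  eq : ∀ {k} → F₅ → (u v w x y z : Polynomial k) → Polynomial k × Polynomial k
  eq b u v w x y z = fivefold (λ x y → x :+ con b :* y) u v w x y z := u :+ con b :* z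

-- From index 5 on, no step of the fold meets the boundary clause of `lin`, so the left side unfolds
-- to `fivefold`.
lin⁵ : ∀ b s n → fold s (lin b) 5 (5 ℕ.+ n) ≡ s n ⊕ b ⊗ s (5 ℕ.+ n)
lin⁵ b s n = fivefold-frobenius b
  (s n) (s (1 ℕ.+ n)) (s (2 ℕ.+ n)) (s (3 ℕ.+ n)) (s (4 ℕ.+ n)) (s (5 ℕ.+ n))

shift : Seq → Seq
shift s zero    = 0F
shift s (suc i) = s i

shift-cong : ∀ {s t} → s ≗ t → shift s ≗ shift t
shift-cong s≗t zero    = refl
shift-cong s≗t (suc i) = s≗t i

lin-shift : ∀ b s → lin b (shift s) ≗ shift (lin b s)
lin-shift b s zero          = F₅.zeroʳ b
lin-shift b s (suc zero)    = F₅.+-identityˡ _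
lin-shift b s (suc (suc i)) = refl

lin^-shift : ∀ b e k s → fold (fold s shift k) (lin b) e ≗ fold (fold s (lin b) e) shift k
lin^-shift b zero    k s i = refl
lin^-shift b (suc e) k s i = trans (lin-cong b (lin^-shift b e k s) i) (lin-shifts k _ i)
  where
  lin-shifts : ∀ k s → lin b (fold s shift k) ≗ fold (lin b s) shift k
  lin-shifts zero    s i = refl
  lin-shifts (suc k) s i = trans (lin-shift b (fold s shift k) i) (shift-cong (lin-shifts k s) i)

shift^-zero : ∀ k s {j} → j < k → fold s shift k j ≡ 0F
shift^-zero (suc k) s {zero}  _         = refl
shift^-zero (suc k) s {suc j} (s≤s j<k) = shift^-zero k s j<k

section : ℕ → Seq → Seq
section j s i = s (i ℕ.* 5 ℕ.+ j)

-- At the indices below 5 the claim is reduced to lin⁵ by multiplying s by x⁵.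
section-lin⁵ : ∀ {j} → j < 5 → ∀ b s → section j (fold s (lin b) 5) ≗ lin b (section j s)
section-lin⁵ {j} _   b s (suc i) = lin⁵ b s (i ℕ.* 5 ℕ.+ j)
section-lin⁵ {j} j<5 b s zero    = begin
  fold s (lin b) 5 j                              ≡⟨ lin^-shift b 5 5 s (5 ℕ.+ j) ⟨
  fold (fold s shift 5) (lin b) 5 (5 ℕ.+ j)       ≡⟨ lin⁵ b (fold s shift 5) j ⟩
  fold s shift 5 j ⊕ b ⊗ s j                      ≡⟨ cong (_⊕ b ⊗ s j) (shift^-zero 5 s j<5) ⟩
  0F ⊕ b ⊗ s j                                    ≡⟨ F₅.+-identityˡ _ ⟩
  b ⊗ s j                                         ∎
  where open ≡-Reasoning

-- Multiplication by (x + b)⁵ = x⁵ + b preserves the residue of an index modulo 5 and acts on each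
-- section as x + b does.
section-lins : ∀ {j} → j < 5 → ∀ {k} (bs : Vec F₅ k) q s →
  section j (lins bs (Vec.map (ℕ._* 5) q) s) ≗ lins bs q (section j s)
section-lins j<5 []       []      s i = refl
section-lins {j} j<5 (b ∷ bs) (e ∷ q) s i =
  trans (section-lins j<5 bs q (fold s (lin b) (e ℕ.* 5)) i) (lins-cong bs q (powers e) i)
  where
  powers : ∀ e → section j (fold s (lin b) (e ℕ.* 5)) ≗ fold (section j s) (lin b) e
  powers zero    i = refl
  powers (suc e) i = trans (section-lin⁵ j<5 b (fold s (lin b) (e ℕ.* 5)) i)
                           (lin-cong b (powers e) i)

lins-scale : ∀ {k} (bs : Vec F₅ k) es c s →
             lins bs es (λ i → c ⊗ s i) ≗ (λ i → c ⊗ lins bs es s i)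
lins-scale []       []       c s i = refl
lins-scale (b ∷ bs) (e ∷ es) c s i =
  trans (lins-cong bs es (powers e) i) (lins-scale bs es c (fold s (lin b) e) i)
  where
  lin-scale : ∀ s → lin b (λ i → c ⊗ s i) ≗ (λ i → c ⊗ lin b s i)
  lin-scale s zero    = solve 3 (λ b c x → b :* (c :* x) := c :* (b :* x)) refl b c (s 0)
  lin-scale s (suc i) =
    solve 4 (λ b c x y → c :* x :+ b :* (c :* y) := c :* (x :+ b :* y)) refl b c (s i) (s (suc i))
  powers : ∀ e → fold (λ i → c ⊗ s i) (lin b) e ≗ (λ i → c ⊗ fold s (lin b) e i)
  powers zero    i = refl
  powers (suc e) i = trans (lin-cong b (powers e) i) (lin-scale _ i)

lins-zero : ∀ {k} (bs : Vec F₅ k) es {s} → s 0 ≡ 0F → lins bs es s 0 ≡ 0F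
lins-zero []       []       s₀ = s₀
lins-zero (b ∷ bs) (e ∷ es) {s} s₀ = lins-zero bs es (powers e)
  where
  powers : ∀ e → fold s (lin b) e 0 ≡ 0F
  powers zero    = s₀
  powers (suc e) = trans (cong (b ⊗_) (powers e)) (F₅.zeroʳ b)

VanishesFrom : ℕ → Seq → Set
VanishesFrom d s = ∀ i → d ≤ i → s i ≡ 0F

lin-vanishes : ∀ b {d s} → VanishesFrom d s → VanishesFrom (suc d) (lin b s)
lin-vanishes b {d} v (suc i) (s≤s d≤i) =
  trans (cong₂ (λ x y → x ⊕ b ⊗ y) (v i d≤i) (v (suc i) (ℕ.m≤n⇒m≤1+n d≤i)))
        (trans (F₅.+-identityˡ _) (F₅.zeroʳ b))

lins-vanishes : ∀ {k} (bs : Vec F₅ k) es {d s} →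
  VanishesFrom d s → VanishesFrom (sum es ℕ.+ d) (lins bs es s)
lins-vanishes []       []       v = v
lins-vanishes (b ∷ bs) (e ∷ es) {d} {s} v =
  subst (λ d → VanishesFrom d (lins bs es (fold s (lin b) e))) (shuffle (sum es) e d)
    (lins-vanishes bs es (powers e))
  where
  powers : ∀ e → VanishesFrom (e ℕ.+ d) (fold s (lin b) e)
  powers zero    = v
  powers (suc e) = lin-vanishes b (powers e)
  shuffle : ∀ x y z → x ℕ.+ (y ℕ.+ z) ≡ y ℕ.+ x ℕ.+ z
  shuffle = ℕ.solve-∀

-- Polynomials as coefficient lists

⟦_⟧ : List F₅ → Seq
⟦ []    ⟧ i       = 0F
⟦ c ∷ h ⟧ zero    = c
⟦ c ∷ h ⟧ (suc i) = ⟦ h ⟧ i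

-- In linFrom b p h the coefficient just below h is p.
linFrom : F₅ → F₅ → List F₅ → List F₅
linFrom b p []      = p ∷ []
linFrom b p (c ∷ h) = p ⊕ b ⊗ c ∷ linFrom b c h

mulLin : F₅ → List F₅ → List F₅
mulLin b = linFrom b 0F

mulLins : ∀ {k} → Vec F₅ k → Vec (Fin 5) k → List F₅ → List F₅
mulLins []       []      h = h
mulLins (b ∷ bs) (e ∷ r) h = mulLins bs r (fold h (mulLin b) (toℕ e))

⟦mulLin⟧ : ∀ b h → ⟦ mulLin b h ⟧ ≗ lin b ⟦ h ⟧
⟦mulLin⟧ b h zero    = trans (at-zero 0F h) (F₅.+-identityˡ _)
  where
  at-zero : ∀ p h → ⟦ linFrom b p h ⟧ 0 ≡ p ⊕ b ⊗ ⟦ h ⟧ 0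
  at-zero p []      = sym (trans (cong (p ⊕_) (F₅.zeroʳ b)) (F₅.+-identityʳ p))
  at-zero p (c ∷ h) = refl
⟦mulLin⟧ b h (suc i) = at-suc 0F h i
  where
  at-suc : ∀ p h i → ⟦ linFrom b p h ⟧ (suc i) ≡ ⟦ h ⟧ i ⊕ b ⊗ ⟦ h ⟧ (suc i)
  at-suc p []       i       = sym (trans (F₅.+-identityˡ _) (F₅.zeroʳ b))
  at-suc p (c ∷ []) zero    = sym (trans (cong (c ⊕_) (F₅.zeroʳ b)) (F₅.+-identityʳ c))
  at-suc p (c ∷ _ ∷ _) zero = refl
  at-suc p (c ∷ h)  (suc i) = at-suc c h i

⟦mulLins⟧ : ∀ {k} (bs : Vec F₅ k) r h → ⟦ mulLins bs r h ⟧ ≗ lins bs (Vec.map toℕ r) ⟦ h ⟧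
⟦mulLins⟧ []       []      h i = refl
⟦mulLins⟧ (b ∷ bs) (e ∷ r) h i =
  trans (⟦mulLins⟧ bs r (fold h (mulLin b) (toℕ e)) i) (lins-cong bs _ (powers (toℕ e)) i)
  where
  powers : ∀ e → ⟦ fold h (mulLin b) e ⟧ ≗ fold ⟦ h ⟧ (lin b) e
  powers zero    i = refl
  powers (suc e) i = trans (⟦mulLin⟧ b (fold h (mulLin b) e) i) (lin-cong b (powers e) i)

length-mulLins : ∀ {k} (bs : Vec F₅ k) r h →
  length (mulLins bs r h) ≡ sum (Vec.map toℕ r) ℕ.+ length h
length-mulLins []       []      h = refl
length-mulLins (b ∷ bs) (e ∷ r) h =
  trans (length-mulLins bs r _) (trans (cong (sum (Vec.map toℕ r) ℕ.+_) (powers (toℕ e)))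
    (shuffle (sum (Vec.map toℕ r)) (toℕ e) (length h)))
  where
  length-linFrom : ∀ p h → length (linFrom b p h) ≡ suc (length h)
  length-linFrom p []      = refl
  length-linFrom p (c ∷ h) = cong suc (length-linFrom c h)
  powers : ∀ e → length (fold h (mulLin b) e) ≡ e ℕ.+ length h
  powers zero    = refl
  powers (suc e) = trans (length-linFrom 0F (fold h (mulLin b) e)) (cong suc (powers e))
  shuffle : ∀ x y z → x ℕ.+ (y ℕ.+ z) ≡ y ℕ.+ x ℕ.+ z
  shuffle = ℕ.solve-∀

pick : ℕ → List F₅ → List F₅
pick _       []      = []
-- The next index of the same residue is five places on, hence four entries of the tail are skipped.
pick zero    (c ∷ h) = c ∷ pick 4 h
pick (suc j) (_ ∷ h) = pick j h

⟦pick⟧ : ∀ j h → ⟦ pick j h ⟧ ≗ section j ⟦ h ⟧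
⟦pick⟧ j       []      i       = refl
⟦pick⟧ zero    (c ∷ h) zero    = refl
⟦pick⟧ zero    (c ∷ h) (suc i) = trans (⟦pick⟧ 4 h i) (cong ⟦ h ⟧ (lemma i))
  where
  lemma : ∀ i → i ℕ.* 5 ℕ.+ 4 ≡ 4 ℕ.+ i ℕ.* 5 ℕ.+ 0
  lemma = ℕ.solve-∀
⟦pick⟧ (suc j) (c ∷ h) i       =
  trans (⟦pick⟧ j h i) (cong ⟦ c ∷ h ⟧ (sym (ℕ.+-suc (i ℕ.* 5) j)))

-- If l entries are picked, the last has index 5 (l - 1) + j, which is below `length h`. Adding 5
-- avoids subtraction and covers l = 0, where `j ≤ 4` suffices.
length-pick : ∀ {j} → j ≤ 4 → ∀ h → length (pick j h) ℕ.* 5 ℕ.+ j ≤ length h ℕ.+ 4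
length-pick {j}     j≤4 []      = j≤4
length-pick {zero}  j≤4 (c ∷ h) =
  s≤s (subst (_≤ length h ℕ.+ 4) (lemma (length (pick 4 h))) (length-pick ℕ.≤-refl h))
  where
  lemma : ∀ i → i ℕ.* 5 ℕ.+ 4 ≡ 4 ℕ.+ i ℕ.* 5 ℕ.+ 0
  lemma = ℕ.solve-∀
length-pick {suc j} j≤4 (c ∷ h) =
  subst (_≤ suc (length h ℕ.+ 4)) (sym (ℕ.+-suc (length (pick j h) ℕ.* 5) j))
    (s≤s (length-pick (ℕ.≤-trans (ℕ.n≤1+n j) j≤4) h))

-- The last entry counts even if it is zero. The default `0F` makes the empty list fail `alive?`.
leading : List F₅ → F₅
leading []                = 0F
leading (c ∷ [])          = c
leading (_ ∷ h@(_ ∷ _))   = leading h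

⟦⟧-vanishes : ∀ c h → leading (c ∷ h) ≡ 0F → VanishesFrom (length h) ⟦ c ∷ h ⟧
⟦⟧-vanishes c []       eq zero    _ = eq
⟦⟧-vanishes c []       eq (suc i) _ = refl
⟦⟧-vanishes c (c′ ∷ h) eq (suc i) (s≤s l≤i) = ⟦⟧-vanishes c′ h eq i l≤i

-- Nonvanishing coefficients and their passage to sections

units : Vec F₅ 4
units = Vec.tabulate Fin.suc

-- No coefficient of h · P m vanishes, up to the degree sum m + length h - 1.
Nonvanishing : List F₅ → Vec ℕ 4 → Set
Nonvanishing h m = ∀ i → i < sum m ℕ.+ length h → lins units m ⟦ h ⟧ i ≢ 0F

-- By `lins-split` and `section-lins`, coefficient i of hⱼ · P q is coefficient 5 i + j of h · P m.
-- It remains to see that this index is in range, which is `bound`.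
Nonvanishing-section : ∀ h m → Nonvanishing h m → ∀ {j} → j ≤ 4 →
  Nonvanishing (pick j (mulLins units (remainders m) h)) (quotients m)
Nonvanishing-section h m nv {j} j≤4 i i< eq = nv (i ℕ.* 5 ℕ.+ j) bound
  (let open ≡-Reasoning in begin
  lins units m ⟦ h ⟧ (i ℕ.* 5 ℕ.+ j)
    ≡⟨ lins-split units m ⟦ h ⟧ (i ℕ.* 5 ℕ.+ j) ⟩
  section j (lins units (Vec.map (ℕ._* 5) q) (lins units (Vec.map toℕ r) ⟦ h ⟧)) i
    ≡⟨ section-lins (s≤s j≤4) units q _ i ⟩
  lins units q (section j (lins units (Vec.map toℕ r) ⟦ h ⟧)) i
    ≡⟨ lins-cong units q (λ i → trans (sym (⟦mulLins⟧ units r h (i ℕ.* 5 ℕ.+ j)))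
                                      (sym (⟦pick⟧ j (mulLins units r h) i))) i ⟩
  lins units q ⟦ pick j (mulLins units r h) ⟧ i
    ≡⟨ eq ⟩
  0F ∎)
  where
  q = quotients m
  r = remainders m
  l = length (pick j (mulLins units r h))
  bound : i ℕ.* 5 ℕ.+ j < sum m ℕ.+ length h
  bound = ℕ.+-cancelʳ-≤ 4 _ _ (begin
    suc (i ℕ.* 5 ℕ.+ j) ℕ.+ 4                      ≡⟨ shuffle₁ i j ⟩
    suc i ℕ.* 5 ℕ.+ j                              ≤⟨ ℕ.+-monoˡ-≤ j (ℕ.*-monoˡ-≤ 5 i<) ⟩
    (sum q ℕ.+ l) ℕ.* 5 ℕ.+ j                      ≡⟨ shuffle₂ (sum q) l j ⟩
    sum q ℕ.* 5 ℕ.+ (l ℕ.* 5 ℕ.+ j)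
      ≤⟨ ℕ.+-monoʳ-≤ (sum q ℕ.* 5) (length-pick j≤4 (mulLins units r h)) ⟩
    sum q ℕ.* 5 ℕ.+ (length (mulLins units r h) ℕ.+ 4)
      ≡⟨ cong (λ l → sum q ℕ.* 5 ℕ.+ (l ℕ.+ 4)) (length-mulLins units r h) ⟩
    sum q ℕ.* 5 ℕ.+ (sum (Vec.map toℕ r) ℕ.+ length h ℕ.+ 4)
      ≡⟨ shuffle₃ (sum q) _ (length h) ⟩
    sum q ℕ.* 5 ℕ.+ sum (Vec.map toℕ r) ℕ.+ length h ℕ.+ 4
      ≡⟨ cong (λ s → s ℕ.+ length h ℕ.+ 4) (sum-split m) ⟨
    sum m ℕ.+ length h ℕ.+ 4                       ∎)
    where
    open ℕ.≤-Reasoning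
    shuffle₁ : ∀ i j → suc (i ℕ.* 5 ℕ.+ j) ℕ.+ 4 ≡ suc i ℕ.* 5 ℕ.+ j
    shuffle₁ = ℕ.solve-∀
    shuffle₂ : ∀ s l j → (s ℕ.+ l) ℕ.* 5 ℕ.+ j ≡ s ℕ.* 5 ℕ.+ (l ℕ.* 5 ℕ.+ j)
    shuffle₂ = ℕ.solve-∀
    shuffle₃ : ∀ s r l → s ℕ.* 5 ℕ.+ (r ℕ.+ l ℕ.+ 4) ≡ s ℕ.* 5 ℕ.+ r ℕ.+ l ℕ.+ 4
    shuffle₃ = ℕ.solve-∀

lins-zero-exponents : ∀ {k} (bs : Vec F₅ k) q s → sum q ≡ 0 →
                      lins bs (Vec.map (ℕ._* 5) q) s ≡ s
lins-zero-exponents []       []         s _  = refl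
lins-zero-exponents (b ∷ bs) (zero ∷ q) s eq = lins-zero-exponents bs q s eq

⟦⟧-nonzero : ∀ h → (∀ i → i < length h → ⟦ h ⟧ i ≢ 0F) → All (_≢ 0F) h
⟦⟧-nonzero []      _  = []
⟦⟧-nonzero (c ∷ h) nz = nz 0 (s≤s z≤n) ∷ ⟦⟧-nonzero h (λ i i< → nz (suc i) (s≤s i<))

-- When the quotients are zero, h · P m is the list `mulLins units (remainders m) h` itself and can
-- be inspected directly.
Nonvanishing-terminal : ∀ h m → Nonvanishing h m → sum (quotients m) ≡ 0 →
                        All (_≢ 0F) (mulLins units (remainders m) h)
Nonvanishing-terminal h m nv q≡0 = ⟦⟧-nonzero (mulLins units r h) λ i i< eq →
  nv i (subst (i <_) length≡ i<) (begin
    lins units m ⟦ h ⟧ i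
      ≡⟨ lins-split units m ⟦ h ⟧ i ⟩
    lins units (Vec.map (ℕ._* 5) (quotients m)) (lins units (Vec.map toℕ r) ⟦ h ⟧) i
      ≡⟨ cong (λ s → s i)
           (lins-zero-exponents units (quotients m) (lins units (Vec.map toℕ r) ⟦ h ⟧) q≡0) ⟩
    lins units (Vec.map toℕ r) ⟦ h ⟧ i
      ≡⟨ ⟦mulLins⟧ units r h i ⟨
    ⟦ mulLins units r h ⟧ i
      ≡⟨ eq ⟩
    0F ∎)
  where
  open ≡-Reasoning
  r = remainders m
  length≡ : length (mulLins units r h) ≡ sum m ℕ.+ length h
  length≡ = trans (length-mulLins units r h) (cong (ℕ._+ length h)
    (trans (cong (λ q → q ℕ.* 5 ℕ.+ sum (Vec.map toℕ r)) (sym q≡0)) (sym (sum-split m))))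

-- A zero constant term of `h` passes to h · P q. Because `0 < sum q`, index 0 is in range even for
-- empty `h`.
Nonvanishing-head : ∀ h q → 0 < sum q → Nonvanishing h q → ⟦ h ⟧ 0 ≢ 0F
Nonvanishing-head h q 0<q nv h₀ =
  nv 0 (ℕ.≤-trans 0<q (ℕ.m≤m+n (sum q) (length h))) (lins-zero units q h₀)

-- A zero last entry lowers the degree of `h`, so the product vanishes at the top index of its
-- range.
Nonvanishing-leading : ∀ h q → 0 < sum q → Nonvanishing h q → leading h ≢ 0F
Nonvanishing-leading []      q 0<q nv _  = Nonvanishing-head [] q 0<q nv refl
Nonvanishing-leading (c ∷ h) q 0<q nv eq =
  nv (sum q ℕ.+ length h) (ℕ.+-monoʳ-< (sum q) (ℕ.n<1+n (length h)))
     (lins-vanishes units q (⟦⟧-vanishes c h eq) _ ℕ.≤-refl)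

-- Junk value: inv 0F = 0F
inv : F₅ → F₅
inv 2F = 3F
inv 3F = 2F
inv x  = x

-- Scaling by a unit does not change which coefficients vanish. Normalising makes proportional
-- polynomials equal, so that states recur.
monic : List F₅ → List F₅
monic h = List.map (inv (leading h) ⊗_) h

Nonvanishing-monic : ∀ h q → leading h ≢ 0F → Nonvanishing h q → Nonvanishing (monic h) q
Nonvanishing-monic h q lead nv i i< eq = nv i
  (subst (λ l → i < sum q ℕ.+ l) (List.length-map (c ⊗_) h) i<)
  (⊗-nonzero c _ (trans (sym (lins-scale units q c ⟦ h ⟧ i))
                   (trans (sym (lins-cong units q (⟦map⟧ h) i)) eq))
             (inv-nonzero (leading h) lead))
  where
  c = inv (leading h)
  ⟦map⟧ : ∀ h → ⟦ List.map (c ⊗_) h ⟧ ≗ (λ i → c ⊗ ⟦ h ⟧ i)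
  ⟦map⟧ []      i       = sym (F₅.zeroʳ c)
  ⟦map⟧ (_ ∷ h) zero    = refl
  ⟦map⟧ (_ ∷ h) (suc i) = ⟦map⟧ h i
  inv-nonzero : ∀ x → x ≢ 0F → inv x ≢ 0F
  inv-nonzero = from-yes (Fin.all? λ x → ¬? (x Fin.≟ 0F) →-dec ¬? (inv x Fin.≟ 0F))

-- Exhaustive search

-- The keys only serve to sort and compare quickly: soundness does not depend on them.
Entry : Set
Entry = ℕ × List F₅

key : List F₅ → ℕ
key = foldr (λ c k → toℕ c ℕ.+ 5 ℕ.* k) 0

entry : List F₅ → Entry
entry h = key h , h

insert : Entry → List Entry → List Entry
insert e []        = e ∷ []
insert e (e′ ∷ es) =
  if proj₁ e <ᵇ proj₁ e′ then e ∷ e′ ∷ es else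
  if proj₁ e ≡ᵇ proj₁ e′ then e′ ∷ es else e′ ∷ insert e es

-- An entry lost to a key collision does no harm: fewer polynomials mean fewer known constraints on
-- `m`, which only makes the search harder.
All-insert : ∀ {p} {P : Entry → Set p} e es → P e → All P es → All P (insert e es)
All-insert e []        pe []         = pe ∷ []
All-insert e (e′ ∷ es) pe (pe′ ∷ pes) with proj₁ e <ᵇ proj₁ e′
... | true  = pe ∷ pe′ ∷ pes
... | false with proj₁ e ≡ᵇ proj₁ e′
...   | true  = pe′ ∷ pes
...   | false = pe′ ∷ All-insert e es pe pes

union : List Entry → List Entry → List Entry
union es es′ = foldr insert es′ es

All-union : ∀ {p} {P : Entry → Set p} es {es′} → All P es → All P es′ → All P (union es es′)
All-union []       []         pes′ = pes′
All-union (e ∷ es) (pe ∷ pes) pes′ = All-insert e (union es _) pe (All-union es pes pes′)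

NonvanishingAt : Vec ℕ 4 → Entry → Set
NonvanishingAt m e = Nonvanishing (proj₂ e) m

-- If h · P q has no vanishing coefficient and q ≢ 0, then h has nonzero extreme coefficients.
alive? : ∀ h → Dec (⟦ h ⟧ 0 ≢ 0F × leading h ≢ 0F)
alive? h = ¬? (⟦ h ⟧ 0 Fin.≟ 0F) ×-dec ¬? (leading h Fin.≟ 0F)

-- The result `nothing` says that some section has a vanishing extreme coefficient, so that no `q`
-- of positive sum is possible.
sections : ℕ → List F₅ → Maybe (List Entry)
sections zero    h = just []
sections (suc j) h =
  if does (alive? (pick j h)) then Maybe.map (insert (entry (monic (pick j h)))) (sections j h)
  else nothing

sections-sound : ∀ k → k ≤ 5 → ∀ h q → 0 < sum q →
  (∀ {j} → j ≤ 4 → Nonvanishing (pick j h) q) →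
  ∃ λ es → sections k h ≡ just es × All (NonvanishingAt q) es
sections-sound zero    _        h q 0<q nv = [] , refl , []
sections-sound (suc j) (s≤s j≤) h q 0<q nv =
  go (alive? (pick j h)) (sections-sound j (ℕ.m≤n⇒m≤1+n j≤) h q 0<q nv)
  where
  go : ∀ (d : Dec (⟦ pick j h ⟧ 0 ≢ 0F × leading (pick j h) ≢ 0F)) {ms} →
       (∃ λ es → ms ≡ just es × All (NonvanishingAt q) es) →
       ∃ λ es → (if does d then Maybe.map (insert (entry (monic (pick j h)))) ms else nothing)
                  ≡ just es
              × All (NonvanishingAt q) es
  go (yes (_ , lead)) (es , refl , all) =
    _ , refl , All-insert (entry (monic (pick j h))) es
      (Nonvanishing-monic (pick j h) q lead (nv j≤)) all
  go (no ¬alive) _ = contradiction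
    ( Nonvanishing-head (pick j h) q 0<q (nv j≤)
    , Nonvanishing-leading (pick j h) q 0<q (nv j≤)) ¬alive

-- What is needed of h · P r: whether m = r is possible, and the polynomials hⱼ, up to scaling, if
-- m ≢ r is possible.
record Leaf : Set where
  constructor leaf
  field
    full : Bool
    next : Maybe (List Entry)

full? : ∀ (h : List F₅) → Dec (All (_≢ 0F) h)
full? = All.all? (λ c → ¬? (c Fin.≟ 0F))

inspectPoly : List F₅ → Leaf
inspectPoly h = leaf (does (full? h)) (sections 5 h)

-- A table indexed by remainder vectors, in which vectors with a common prefix share their partial
-- products.
data Trie (A : Set) : ℕ → Set where
  tip  : A → Trie A 0
  node : ∀ {n} → Vec (Trie A n) 5 → Trie A (suc n)

look : ∀ {A n} → Trie A n → Vec (Fin 5) n → A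
look (tip a)   []       = a
look (node ts) (i ∷ is) = look (lookup ts i) is

build : ∀ {n} → Vec F₅ n → List F₅ → Trie Leaf n
build []       h = tip (inspectPoly h)
build (b ∷ bs) h =
  let h₁ = mulLin b h ; h₂ = mulLin b h₁ ; h₃ = mulLin b h₂ ; h₄ = mulLin b h₃ in
  node (build bs h ∷ build bs h₁ ∷ build bs h₂ ∷ build bs h₃ ∷ build bs h₄ ∷ [])

look-build : ∀ {n} (bs : Vec F₅ n) h r → look (build bs h) r ≡ inspectPoly (mulLins bs r h)
look-build []       h []       = refl
look-build (b ∷ bs) h (0F ∷ r) = look-build bs (fold h (mulLin b) 0) r
look-build (b ∷ bs) h (1F ∷ r) = look-build bs (fold h (mulLin b) 1) r
look-build (b ∷ bs) h (2F ∷ r) = look-build bs (fold h (mulLin b) 2) r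
look-build (b ∷ bs) h (3F ∷ r) = look-build bs (fold h (mulLin b) 3) r
look-build (b ∷ bs) h (4F ∷ r) = look-build bs (fold h (mulLin b) 4) r

-- Every row is inspected for many states.  It is stored in a table which is passed as an argument,
-- because Agda shares the evaluation of arguments but not that of top-level definitions.
Row : List F₅ → Set
Row h = ∃ λ t → ∀ r → look t r ≡ inspectPoly (mulLins units r h)

row : ∀ h → Row h
row h = build units h , look-build units h

Table : Set
Table = List (ℕ × ∃ Row)

-- A missing polynomial or a misleading key only causes the row to be recomputed.
find : Table → ∀ e → Row (proj₂ e)
find []                   (k′ , h′) = row h′
find ((k , h , ro) ∷ table) (k′ , h′) =
  if k ≡ᵇ k′ then reuse (List.≡-dec Fin._≟_ h h′) else find table (k′ , h′)
  where
  reuse : Dec (h ≡ h′) → Row h′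
  reuse (yes refl) = ro
  reuse (no _)     = row h′

Rows : List Entry → Set
Rows = All (Row ∘ proj₂)

allFull : ∀ {H} → Rows H → Vec (Fin 5) 4 → Bool
allFull []               r = true
allFull ((t , _) ∷ rows) r = Leaf.full (look t r) ∧ allFull rows r

allFull-sound : ∀ {H} (rows : Rows H) m → sum (quotients m) ≡ 0 →
                All (NonvanishingAt m) H → allFull rows (remainders m) ≡ true
allFull-sound []                    m q≡0 []         = refl
allFull-sound {e ∷ _} ((t , t≡) ∷ rows) m q≡0 (nv ∷ nvs) = cong₂ _∧_
  (trans (cong Leaf.full (t≡ (remainders m)))
         (dec-true (full? (mulLins units (remainders m) (proj₂ e)))
           (Nonvanishing-terminal (proj₂ e) m nv q≡0)))
  (allFull-sound rows m q≡0 nvs)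

-- One polynomial without continuation rules out nonzero quotients for the whole set, hence
-- `nothing` propagates.
allNext : ∀ {H} → Rows H → Vec (Fin 5) 4 → Maybe (List Entry)
allNext []               r = just []
allNext ((t , _) ∷ rows) r = Maybe.zipWith union (Leaf.next (look t r)) (allNext rows r)

allNext-sound : ∀ {H} (rows : Rows H) m → 0 < sum (quotients m) → All (NonvanishingAt m) H →
  ∃ λ es → allNext rows (remainders m) ≡ just es × All (NonvanishingAt (quotients m)) es
allNext-sound []                        m 0<q []         = [] , refl , []
allNext-sound {e ∷ _} ((t , t≡) ∷ rows) m 0<q (nv ∷ nvs) =
  let es , eq , all = sections-sound 5 ℕ.≤-refl (mulLins units (remainders m) (proj₂ e))
                        (quotients m) 0<q (Nonvanishing-section (proj₂ e) m nv)
      es′ , eq′ , all′ = allNext-sound rows m 0<q nvs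
  in union es es′
   , cong₂ (Maybe.zipWith union) (trans (cong Leaf.next (t≡ (remainders m))) eq) eq′
   , All-union es all all′

-- The claim attached to a state is that carry + sum m has at most budget nonzero digits whenever
-- h · P m has no vanishing coefficient for all h in polys.
record State : Set where
  constructor state
  field
    polys  : List Entry
    carry  : ℕ
    budget : ℕ

open State

SafeBelow : ℕ → State → Set
SafeBelow k s = ∀ m → sum m < k → All (NonvanishingAt m) (polys s) →
                nonzeroDigits₅ (carry s ℕ.+ sum m) ≤ budget s

pay : ℕ → ℕ → Maybe ℕ
pay zero    b       = just b
pay (suc _) zero    = nothing
pay (suc _) (suc b) = just b

pay-sound : ∀ d b {b′} → pay d b ≡ just b′ → sgn d ℕ.+ b′ ≡ b
pay-sound zero    b       refl = refl
pay-sound (suc d) (suc b) refl = refl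

-- This treats the case that all quotients are zero, where the number to be counted is `e`. From
-- carry 1 the carries never exceed 3, so `e` is at most 19 and `weight 2` is exact.
affordable : ∀ {H} → Rows H → ℕ → ℕ → Vec (Fin 5) 4 → Bool
affordable rows e b r = if allFull rows r then weight 2 e ≤ᵇ b else true

successor : ℕ → ℕ → List Entry → Maybe (List State)
successor e b H = Maybe.map (λ b′ → state H (e / 5) b′ ∷ []) (pay (e % 5) b)

-- nothing means that the search fails, just [] that r has no successor.
step : ∀ {H} → Rows H → ℕ → ℕ → Vec (Fin 5) 4 → Maybe (List State)
step rows c b r =
  if affordable rows e b r
  then maybe′ (successor e b) (just []) (allNext rows r)
  else nothing
  where e = c ℕ.+ sum (Vec.map toℕ r)

step-sound : ∀ {H} (rows : Rows H) c b m {ss} → step rows c b (remainders m) ≡ just ss →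
             All (SafeBelow (sum m)) ss → All (NonvanishingAt m) H →
             nonzeroDigits₅ (c ℕ.+ sum m) ≤ b
step-sound {H} rows c b m eq safe nvs =
  subst (λ n → nonzeroDigits₅ n ≤ b) (sym carry-over) (go q (affordable rows e b r) refl refl eq)
  where
  q = sum (quotients m)
  r = remainders m
  e = c ℕ.+ sum (Vec.map toℕ r)

  -- The lowest digit is `e % 5`, and what remains is the new carry `e / 5` plus the sum of the
  -- quotients.
  carry-over : c ℕ.+ sum m ≡ e % 5 ℕ.+ (e / 5 ℕ.+ q) ℕ.* 5
  carry-over = begin
    c ℕ.+ sum m                          ≡⟨ cong (c ℕ.+_) (sum-split m) ⟩
    c ℕ.+ (q ℕ.* 5 ℕ.+ _)                ≡⟨ shuffle₁ c q _ ⟩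
    e ℕ.+ q ℕ.* 5                        ≡⟨ cong (ℕ._+ q ℕ.* 5) (m≡m%n+[m/n]*n e 5) ⟩
    e % 5 ℕ.+ e / 5 ℕ.* 5 ℕ.+ q ℕ.* 5    ≡⟨ shuffle₂ (e % 5) (e / 5) q ⟩
    e % 5 ℕ.+ (e / 5 ℕ.+ q) ℕ.* 5        ∎
    where
    open ≡-Reasoning
    shuffle₁ : ∀ c q r → c ℕ.+ (q ℕ.* 5 ℕ.+ r) ≡ c ℕ.+ r ℕ.+ q ℕ.* 5
    shuffle₁ = ℕ.solve-∀
    shuffle₂ : ∀ d x q → d ℕ.+ x ℕ.* 5 ℕ.+ q ℕ.* 5 ≡ d ℕ.+ (x ℕ.+ q) ℕ.* 5
    shuffle₂ = ℕ.solve-∀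

  terminal : q ≡ 0 → affordable rows e b r ≡ true →
             nonzeroDigits₅ (e % 5 ℕ.+ (e / 5 ℕ.+ q) ℕ.* 5) ≤ b
  terminal q≡0 ok = subst (λ n → nonzeroDigits₅ n ≤ b) e≡
    (ℕ.≤-trans (nonzeroDigits₅-≤-weight 2 e)
      (ℕ.≤ᵇ⇒≤ (weight 2 e) b (subst T (sym (trans (sym full) ok)) _)))
    where
    full : affordable rows e b r ≡ (weight 2 e ≤ᵇ b)
    full = cong (λ f → if f then weight 2 e ≤ᵇ b else true) (allFull-sound rows m q≡0 nvs)
    e≡ : e ≡ e % 5 ℕ.+ (e / 5 ℕ.+ q) ℕ.* 5
    e≡ = trans (m≡m%n+[m/n]*n e 5) (cong (λ x → e % 5 ℕ.+ x ℕ.* 5)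
           (sym (trans (cong (e / 5 ℕ.+_) q≡0) (ℕ.+-identityʳ (e / 5)))))

  q<sum : 0 < q → q < sum m
  q<sum 0<q = subst (q <_) (sym (sum-split m))
    (ℕ.≤-trans (ℕ.m<m*n q 5 {{ℕ.>-nonZero 0<q}} (s≤s (s≤s z≤n))) (ℕ.m≤m+n (q ℕ.* 5) _))

  nonterminal : 0 < q → ∀ H′ b′ → pay (e % 5) b ≡ just b′ →
                SafeBelow (sum m) (state H′ (e / 5) b′) →
                All (NonvanishingAt (quotients m)) H′ →
                nonzeroDigits₅ (e % 5 ℕ.+ (e / 5 ℕ.+ q) ℕ.* 5) ≤ b
  nonterminal 0<q H′ b′ paid safe nvs′ = begin
    nonzeroDigits₅ (e % 5 ℕ.+ (e / 5 ℕ.+ q) ℕ.* 5)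
      ≡⟨ nonzeroDigits₅-step (m%n<n e 5) (e / 5 ℕ.+ q) ⟩
    sgn (e % 5) ℕ.+ nonzeroDigits₅ (e / 5 ℕ.+ q)
      ≤⟨ ℕ.+-monoʳ-≤ (sgn (e % 5)) (safe (quotients m) (q<sum 0<q) nvs′) ⟩
    sgn (e % 5) ℕ.+ b′
      ≡⟨ pay-sound (e % 5) b paid ⟩
    b ∎
    where open ℕ.≤-Reasoning

  paying : 0 < q → ∀ H′ → All (NonvanishingAt (quotients m)) H′ →
           ∀ p → pay (e % 5) b ≡ p → ∀ {ss} →
           Maybe.map (λ b′ → state H′ (e / 5) b′ ∷ []) p ≡ just ss → All (SafeBelow (sum m)) ss →
           nonzeroDigits₅ (e % 5 ℕ.+ (e / 5 ℕ.+ q) ℕ.* 5) ≤ b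
  paying 0<q H′ nvs′ (just b′) paid refl (safe ∷ []) = nonterminal 0<q H′ b′ paid safe nvs′

  go : ∀ q′ ok → q ≡ q′ → affordable rows e b r ≡ ok →
       (if ok then maybe′ (successor e b) (just []) (allNext rows r) else nothing) ≡ just _ →
       nonzeroDigits₅ (e % 5 ℕ.+ (e / 5 ℕ.+ q) ℕ.* 5) ≤ b
  go zero    true q≡  ok eq = terminal q≡ ok
  go (suc _) true q≡  ok eq =
    let 0<q = subst (0 <_) (sym q≡) (s≤s z≤n)
        H′ , next≡ , nvs′ = allNext-sound rows m 0<q nvs
    in paying 0<q H′ nvs′ (pay (e % 5) b) refl
         (trans (sym (cong (maybe′ (successor e b) (just [])) next≡)) eq) safe

-- Exploration of the states

collect : ∀ {a b} {A : Set a} {B : Set b} → (A → Maybe (List B)) → List A → Maybe (List B)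
collect f []       = just []
collect f (x ∷ xs) = Maybe.zipWith _++_ (f x) (collect f xs)

collect-sound : ∀ {a b p} {A : Set a} {B : Set b} {P : B → Set p}
  (f : A → Maybe (List B)) xs {ys} →
  collect f xs ≡ just ys → All P ys → ∀ {x} → x ∈ xs → ∃ λ zs → f x ≡ just zs × All P zs
collect-sound f (x ∷ xs) eq all x∈ with f x in fx | collect f xs in fxs
collect-sound f (x ∷ xs) refl all (here refl) | just zs | just ys = zs , fx , All.++⁻ˡ zs all
collect-sound f (x ∷ xs) refl all (there x∈)  | just zs | just ys =
  collect-sound f xs fxs (All.++⁻ʳ zs all) x∈

exponents : ∀ n → List (Vec (Fin 5) n)
exponents zero    = [] ∷ []
exponents (suc n) = cartesianProductWith _∷_ (allFin 5) (exponents n)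

∈-exponents : ∀ {n} (r : Vec (Fin 5) n) → r ∈ exponents n
∈-exponents []      = here refl
∈-exponents (e ∷ r) = ∈-cartesianProductWith⁺ _∷_ (∈-allFin e) (∈-exponents r)

expand : Table → State → Maybe (List State)
expand table (state H c b) = collect (step (All.universal (find table) H) c b) (exponents 4)

-- Successors are consulted only at sums below `sum m`, and `sum m` is at most `k`.
expand-sound : ∀ table s {ss} → expand table s ≡ just ss →
               ∀ k → All (SafeBelow k) ss → SafeBelow (suc k) s
expand-sound table (state H c b) eq k safe m (s≤s m≤k) nvs =
  let ss , step≡ , safe′ =
        collect-sound (step rows c b) (exponents 4) eq safe (∈-exponents (remainders m))
  in step-sound rows c b m step≡
       (All.map (λ safe m′ m′<m → safe m′ (ℕ.<-≤-trans m′<m m≤k)) safe′) nvs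
  where rows = All.universal (find table) H

-- The smaller budget is the stronger claim, so a visited state settles any later one that differs
-- only by a larger budget.
Covers : State → State → Set
Covers s v = carry s ≡ carry v × budget v ≤ budget s × polys v ≡ polys s

covers? : ∀ s v → Dec (Covers s v)
covers? s v = (carry s ℕ.≟ carry v) ×-dec (budget v ℕ.≤? budget s) ×-dec
              (List.≡-dec (Product.≡-dec ℕ._≟_ (List.≡-dec Fin._≟_)) (polys v) (polys s))

covers-sound : ∀ {k s v} → Covers s v → SafeBelow k v → SafeBelow k s
covers-sound {s = state _ _ _} {state _ _ _} (refl , b≤ , refl) safe m m<k nvs =
  ℕ.≤-trans (safe m m<k nvs) b≤

run : Table → ℕ → List State → List State → Bool
run table _       visited []         = true
run table zero    visited (_ ∷ _)    = false
run table (suc n) visited (s ∷ todo) =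
  if does (any? (covers? s) visited)
  then run table n visited todo
  else maybe′ (λ ss → run table n (s ∷ visited) (todo ++ ss)) false (expand table s)

-- Since the sum of the exponents decreases from m to q, visited states may assume each other's
-- claims for smaller sums, so cycles of states do no harm.
Closed : List State → List State → Set
Closed visited todo = ∀ k → All (SafeBelow k) visited → All (SafeBelow k) todo →
                      All (SafeBelow (suc k)) visited

run-sound : ∀ table n visited todo → run table n visited todo ≡ true → Closed visited todo →
            ∀ k → All (SafeBelow k) visited × All (SafeBelow k) todo
run-sound table n visited [] ok closed k = below k , []
  where
  -- With an empty agenda, `Closed` is exactly the induction step; below 0 the claims are vacuous.
  below : ∀ k → All (SafeBelow k) visited
  below zero    = All.universal (λ s m ()) visited
  below (suc k) = closed k (below k) []
run-sound table (suc n) visited (s ∷ todo) ok closed =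
  go (any? (covers? s) visited) (expand table s) refl ok
  where
  lookupSafe : ∀ {k} vs → Any (Covers s) vs → All (SafeBelow k) vs → SafeBelow k s
  lookupSafe (v ∷ vs) (here c)  (safe ∷ _) = covers-sound {s = s} {v} c safe
  lookupSafe (v ∷ vs) (there c) (_ ∷ safe) = lookupSafe vs c safe

  go : ∀ (covered : Dec (Any (Covers s) visited)) x → expand table s ≡ x →
       (if does covered then run table n visited todo
        else maybe′ (λ ss → run table n (s ∷ visited) (todo ++ ss)) false x) ≡ true →
       ∀ k → All (SafeBelow k) visited × All (SafeBelow k) (s ∷ todo)
  go (yes c) _ _ ok k =
    let safeᵛ , safeᵗ = run-sound table n visited todo ok
          (λ k safeᵛ safeᵗ → closed k safeᵛ (lookupSafe visited c safeᵛ ∷ safeᵗ)) k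
    in safeᵛ , lookupSafe visited c safeᵛ ∷ safeᵗ
  go (no _) (just ss) eq ok k with run-sound table n (s ∷ visited) (todo ++ ss) ok
    -- Moving `s` to the visited states preserves `Closed`: its own claim follows from its
    -- successors, now on the agenda, and the older states may use `s` as visited.
    (λ { k (safeˢ ∷ safeᵛ) safe →
         expand-sound table s eq k (All.++⁻ʳ todo safe)
       ∷ closed k safeᵛ (safeˢ ∷ All.++⁻ˡ todo safe) }) k
  ... | safeˢ ∷ safeᵛ , safe = safeᵛ , safeˢ ∷ All.++⁻ˡ todo safe

-- Here h = 1, and carry 1 turns the degree `sum m` into the number whose digits are counted.
start : State
start = state (entry (1F ∷ []) ∷ []) 1 4

monicPolys : ℕ → List (List F₅)
monicPolys zero    = (1F ∷ []) ∷ []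
monicPolys (suc n) = cartesianProductWith _∷_ (allFin 5) (monicPolys n)

table : Table
table = List.map (λ h → key h , h , row h)
          -- Four coefficients of h and at most 16 linear factors give at most 20 coefficients,
          -- hence at most 4 per section: degree 3 is never exceeded.
          (monicPolys 0 ++ monicPolys 1 ++ monicPolys 2 ++ monicPolys 3)

-- 414 states are expanded; the fuel exceeds the number of states ever put on the agenda.
run-start : run table 3000 [] (start ∷ []) ≡ true
run-start = refl

-- Reduction of the polynomial modulo 5

open IntegerHom F₅-commutativeRing renaming
  (ι to reduce; ι-+ to reduce-+; ι-* to reduce-*)

reduce≡0⇒5∣ : ∀ i → reduce i ≡ 0F → + 5 ∣ i
reduce≡0⇒5∣ (+ n) eq = go n eq
  where
  period : ∀ x → 1F ⊕ (1F ⊕ (1F ⊕ (1F ⊕ (1F ⊕ x)))) ≡ x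
  period = from-yes (Fin.all? λ x → 1F ⊕ (1F ⊕ (1F ⊕ (1F ⊕ (1F ⊕ x)))) Fin.≟ x)
  go : ∀ n → reduce (+ n) ≡ 0F → 5 ℕ.∣ n
  go 0 _  = 5 ℕ.∣0
  go 1 ()
  go 2 ()
  go 3 ()
  go 4 ()
  go (suc (suc (suc (suc (suc n))))) eq =
    ℕ.∣m∣n⇒∣m+n ℕ.∣-refl (go n (trans (sym (period (reduce (+ n)))) eq))
reduce≡0⇒5∣ -[1+ n ] eq = reduce≡0⇒5∣ (+ suc n) (⊖-zero _ eq)
  where
  ⊖-zero : ∀ x → ⊖ x ≡ 0F → x ≡ 0F
  ⊖-zero = from-yes (Fin.all? λ x → (⊖ x Fin.≟ 0F) →-dec (x Fin.≟ 0F))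

coefficients : ∀ {n} → Vec ℤ n → Seq
coefficients []      i       = 0F
coefficients (a ∷ f) zero    = reduce a
coefficients (a ∷ f) (suc i) = coefficients f i

coefficients-lookup : ∀ {n} (f : Vec ℤ n) i → coefficients f (toℕ i) ≡ reduce (lookup f i)
coefficients-lookup (a ∷ f) Fin.zero    = refl
coefficients-lookup (a ∷ f) (Fin.suc i) = coefficients-lookup f i

-- The constant terms in f = (x - p) g + f(p). Keeping the remainder allows its use for the tails of
-- `f`, which yields the higher coefficients in `coefficients-quotient`.
constant-coefficient : ∀ {n} p (f : Poly ℤ n) →
  coefficients f 0 ≡ reduce (ℤ.- p) ⊗ coefficients (quotient p f) 0 ⊕ reduce (evalℤ f p)
constant-coefficient p (a ∷ []) = begin
  reduce a                                              ≡⟨ cong reduce (lemma a p) ⟩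
  reduce (a ℤ.+ p ℤ.* 0ℤ)                               ≡⟨ F₅.+-identityˡ _ ⟨
  0F ⊕ reduce (a ℤ.+ p ℤ.* 0ℤ)
    ≡⟨ cong (_⊕ reduce (a ℤ.+ p ℤ.* 0ℤ)) (F₅.zeroʳ (reduce (ℤ.- p))) ⟨
  reduce (ℤ.- p) ⊗ 0F ⊕ reduce (a ℤ.+ p ℤ.* 0ℤ)         ∎
  where
  open ≡-Reasoning
  lemma : ∀ a p → a ≡ a ℤ.+ p ℤ.* 0ℤ
  lemma = ℤ.solve-∀
constant-coefficient p (a ∷ f@(_ ∷ _)) = begin
  reduce a
    ≡⟨ cong reduce (lemma a p (evalℤ f p)) ⟩
  reduce (ℤ.- p ℤ.* evalℤ f p ℤ.+ (a ℤ.+ p ℤ.* evalℤ f p))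
    ≡⟨ reduce-+ (ℤ.- p ℤ.* evalℤ f p) _ ⟩
  reduce (ℤ.- p ℤ.* evalℤ f p) ⊕ reduce (a ℤ.+ p ℤ.* evalℤ f p)
    ≡⟨ cong (_⊕ reduce (a ℤ.+ p ℤ.* evalℤ f p)) (reduce-* (ℤ.- p) (evalℤ f p)) ⟩
  reduce (ℤ.- p) ⊗ reduce (evalℤ f p) ⊕ reduce (a ℤ.+ p ℤ.* evalℤ f p) ∎
  where
  open ≡-Reasoning
  lemma : ∀ a p e → a ≡ ℤ.- p ℤ.* e ℤ.+ (a ℤ.+ p ℤ.* e)
  lemma = ℤ.solve-∀

coefficients-quotient : ∀ {n} p (f : Poly ℤ n) → evalℤ f p ≡ 0ℤ →
  coefficients f ≗ lin (reduce (ℤ.- p)) (coefficients (quotient p f))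
coefficients-quotient p f fp≡0 zero = trans (constant-coefficient p f)
  (trans (cong (λ e → reduce (ℤ.- p) ⊗ coefficients (quotient p f) 0 ⊕ reduce e) fp≡0)
         (F₅.+-identityʳ _))
coefficients-quotient p f fp≡0 (suc i) = higher f i
  where
  b = reduce (ℤ.- p)
  higher : ∀ {n} (f : Poly ℤ n) i → coefficients f (suc i) ≡
           coefficients (quotient p f) i ⊕ b ⊗ coefficients (quotient p f) (suc i)
  higher (a ∷ [])        i       = sym (trans (F₅.+-identityˡ _) (F₅.zeroʳ b))
  higher (a ∷ f@(_ ∷ _)) zero    = trans (constant-coefficient p f)
    (F₅.+-comm (b ⊗ coefficients (quotient p f) 0) (reduce (evalℤ f p)))
  higher (a ∷ f@(_ ∷ _)) (suc i) = higher f i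

linearProduct : ∀ {n} → Vec F₅ n → Seq
linearProduct = Vec.foldr′ lin ⟦ 1F ∷ [] ⟧

splits : ∀ {c ℓ₁ ℓ₂} (K : HeytingField c ℓ₁ ℓ₂) → CharacteristicZero K → AlgebraicallyClosed K →
  ∀ {n} (f : Poly ℤ n) → Monic f → (∀ z → IsRoot K f z → IsRational K z) →
  ∃ λ (bs : Vec F₅ n) → coefficients f ≗ linearProduct bs
splits K char0 closed {zero} (a ∷ []) monic rational =
  [] , λ { zero → cong reduce monic ; (suc i) → refl }
splits K char0 closed {suc n} f monic rational =
  let p , fp≡0 = integer-root K char0 closed f monic rational
      g        = quotient p f
      bs , eq  = splits K char0 closed g (trans (last-quotient p f) monic)
                   (λ z root → rational z (quotient-root K f p fp≡0 z root))
      b        = reduce (ℤ.- p)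
  in b ∷ bs , λ i → trans (coefficients-quotient p f fp≡0 i) (lin-cong b eq i)

lin-lins : ∀ {k} (bs : Vec F₅ k) m j s →
           lin (lookup bs j) (lins bs m s) ≗ lins bs (m [ j ]%= suc) s
lin-lins (b ∷ bs) (e ∷ m) Fin.zero    s i = sym (lins-lin bs m b _ i)
lin-lins (b ∷ bs) (e ∷ m) (Fin.suc j) s i = lin-lins bs m j _ i

sum-increment : ∀ {k} (m : Vec ℕ k) j → sum (m [ j ]%= suc) ≡ suc (sum m)
sum-increment (e ∷ m) Fin.zero    = refl
sum-increment (e ∷ m) (Fin.suc j) = trans (cong (e ℕ.+_) (sum-increment m j)) (ℕ.+-suc e (sum m))

-- The constant term is the product of all entries of `bs`, so none of them is `0F`, and each factor
-- raises one exponent.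
collectExponents : ∀ {n} (bs : Vec F₅ n) → linearProduct bs 0 ≢ 0F →
  ∃ λ m → sum m ≡ n × linearProduct bs ≗ lins units m ⟦ 1F ∷ [] ⟧
collectExponents []              _  = Vec.replicate 4 0 , refl , λ _ → refl
collectExponents (0F ∷ bs)        b₀≢0 = contradiction (F₅.zeroˡ (linearProduct bs 0)) b₀≢0
collectExponents (Fin.suc j ∷ bs) b₀≢0 =
  let m , sum≡ , eq = collectExponents bs
        (λ eq → b₀≢0 (trans (cong (Fin.suc j ⊗_) eq) (F₅.zeroʳ (Fin.suc j))))
  in m [ j ]%= suc
   , trans (sum-increment m j) (cong suc sum≡)
   , λ i → trans (lin-cong (Fin.suc j) eq i)
       (trans (cong (λ b → lin b (lins units m ⟦ 1F ∷ [] ⟧) i)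
                    (sym (Vec.lookup∘tabulate Fin.suc j)))
              (lin-lins units m j ⟦ 1F ∷ [] ⟧ i))

start-safe : ∀ k → SafeBelow k start
start-safe k = All.head (proj₂
  (run-sound table 3000 [] (start ∷ []) run-start (λ _ _ _ → []) k))

mainTheorem2 : ∀ {c ℓ₁ ℓ₂} (K : HeytingField c ℓ₁ ℓ₂) →
    CharacteristicZero K → AlgebraicallyClosed K →
    ∀ (n : ℕ) (f : Poly ℤ n) → Monic f →
    (∀ (z : HeytingField.Carrier K) → IsRoot K f z → IsRational K z) →
    (∀ (i : Fin (suc n)) → ¬ (+ 5 ∣ lookup f i)) →
    nonzeroDigits₅ (suc n) ≤ 4
mainTheorem2 K char0 closed n f monic rational 5∤f =
  let bs , f≗ = splits K char0 closed f monic rational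
      m , sum≡ , bs≗ = collectExponents bs (λ eq → nonzero 0 (s≤s ℕ.z≤n) (trans (f≗ 0) eq))
      nonvanishing : Nonvanishing (1F ∷ []) m
      nonvanishing i i< eq = nonzero i
        (subst (i <_) (trans (ℕ.+-comm (sum m) 1) (cong suc sum≡)) i<)
        (trans (f≗ i) (trans (bs≗ i) eq))
  in subst (λ n → nonzeroDigits₅ (suc n) ≤ 4) sum≡
       -- The bound `suc (sum m)` is the least that admits `m` itself.
       (start-safe (suc (sum m)) m ℕ.≤-refl (nonvanishing ∷ []))
  where
  nonzero : ∀ i → i < suc n → coefficients f i ≢ 0F
  nonzero i i<1+n eq = 5∤f (fromℕ< i<1+n) (reduce≡0⇒5∣ (lookup f (fromℕ< i<1+n))
    (trans (sym (coefficients-lookup f (fromℕ< i<1+n)))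
           (trans (cong (coefficients f) (Fin.toℕ-fromℕ< i<1+n)) eq)))
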